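{- Let $p,q\in\mathbb{R}[x]$ be polynomials such that $\mathscr{W}(p)$ and $\mathscr{W}(q)$ are symmetric and $\operatorname{defect}(p)=\operatorname{defect}(q)$. Then $\mathscr{W}(pq)$ is symmetric and $\operatorname{defect}(pq)=\operatorname{defect}(p)=\operatorname{defect}(q)$. Furthermore, if $\mathscr{W}(p)$ and $\mathscr{W}(q)$ are $\gamma$-positive, then $\mathscr{W}(pq)$ is $\gamma$-positive.
   Context: For a polynomial $p\in\mathbb{R}[x]$ of degree $d$, $\mathscr{W}(p)$ denotes the polynomial of degree at most $d$ defined by $\sum_{j\ge0}p(j)x^j=\mathscr{W}(p)(x)/(1-x)^{d+1}$. For a polynomial $a$ of degree at most $s$, let $\mathcal{I}_s(a)(x)=x^s a(1/x)$; $a$ is symmetric with center of symmetry $s/2$ if $\mathcal{I}_s(a)=a$. We say $\mathscr{W}(p)$ is symmetric if $\mathcal{I}_s\mathscr{W}(p)=\mathscr{W}(p)$ for some $s\le \deg p$, and then the defect of $p$ is $\operatorname{defect}(p)=\deg p - s$. A polynomial $a$ symmetric with center $s/2$ can be uniquely written as $a(x)=\sum_{i=0}^{\lfloor s/2\rfloor}\gamma_i x^i(1+x)^{s-2i}$; it is $\gamma$-positive if all $\gamma_i\ge 0$. -}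

module Defs where

open import Level using (Level; _⊔_)
open import Algebra.Bundles using (CommutativeRing)
open import Relation.Binary.Structures using (IsTotalOrder)
open import Relation.Nullary using (¬_)
open import Data.Product using (Σ; ∃; _×_)
open import Data.Nat as ℕ using (ℕ; zero; suc; _∸_; ⌊_/2⌋)
open import Data.Nat.Combinatorics using (_C_)
open import Data.Fin using (Fin; toℕ)
open import Data.Vec using (Vec; []; _∷_; replicate; tabulate; lookup; _++_)

record OrderedField (c ℓ : Level) : Set (Level.suc (c ⊔ ℓ)) where
  field
    commutativeRing : CommutativeRing c ℓ
  open CommutativeRing commutativeRing public
  field
    _≤ᶠ_        : Carrier → Carrier → Set ℓ
    isTotalOrder : IsTotalOrder _≈_ _≤ᶠ_
    +-monoʳ     : ∀ {a b} z → a ≤ᶠ b → (a + z) ≤ᶠ (b + z)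
    *-nonneg    : ∀ {a b} → 0# ≤ᶠ a → 0# ≤ᶠ b → 0# ≤ᶠ (a * b)
    inverse     : ∀ a → ¬ (a ≈ 0#) → ∃ λ b → (a * b) ≈ 1#
    0≉1         : ¬ (0# ≈ 1#)

-- Polynomials over an ordered field F, represented by coefficient vectors
-- (constant coefficient first).  A polynomial of degree d is a vector of
-- length suc d whose last entry is nonzero.

module Poly {c ℓ : Level} (F : OrderedField c ℓ) where
  open OrderedField F

  NonZeroF : Carrier → Set ℓ
  NonZeroF a = ¬ (a ≈ 0#)

  coeff : ∀ {n} → Vec Carrier n → ℕ → Carrier
  coeff []       _       = 0#
  coeff (a ∷ as) zero    = a
  coeff (a ∷ as) (suc i) = coeff as i

  lead : ∀ {n} → Vec Carrier (suc n) → Carrier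
  lead (a ∷ [])      = a
  lead (a ∷ b ∷ as)  = lead (b ∷ as)

  eval : ∀ {n} → Vec Carrier n → Carrier → Carrier
  eval []       x = 0#
  eval (a ∷ as) x = a + x * eval as x

  fromℕ : ℕ → Carrier
  fromℕ zero    = 0#
  fromℕ (suc n) = 1# + fromℕ n

  sumTo : ℕ → (ℕ → Carrier) → Carrier
  sumTo zero    f = 0#
  sumTo (suc n) f = sumTo n f + f n

  mul : ∀ {d e} → Vec Carrier (suc d) → Vec Carrier (suc e) → Vec Carrier (suc (d ℕ.+ e))
  mul p q = tabulate λ (k : Fin _) →
    sumTo (suc (toℕ k)) (λ i → coeff p i * coeff q (toℕ k ∸ i))

  oneMinusX : Vec Carrier 2
  oneMinusX = 1# ∷ (- 1#) ∷ []

  onePlusX : Vec Carrier 2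
  onePlusX = 1# ∷ 1# ∷ []

  pow : Vec Carrier 2 → (n : ℕ) → Vec Carrier (suc n)
  pow b zero    = 1# ∷ []
  pow b (suc n) = mul b (pow b n)

  shift : ∀ {n} (i : ℕ) → Vec Carrier n → Vec Carrier (i ℕ.+ n)
  shift i v = replicate i 0# ++ v

  -- 𝒲(p) for p of degree d: the polynomial (of degree ≤ d) with
  --   Σ_{j≥0} p(j) x^j = 𝒲(p)(x) / (1-x)^{d+1},
  -- i.e. the coefficients 0..d of the power series (1-x)^{d+1} · Σ_j p(j) x^j.
  W : (d : ℕ) → Vec Carrier (suc d) → Vec Carrier (suc d)
  W d p = tabulate λ (k : Fin (suc d)) →
    sumTo (suc (toℕ k)) (λ i → coeff (pow oneMinusX (suc d)) i * eval p (fromℕ (toℕ k ∸ i)))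

  -- a is symmetric with center of symmetry s/2, i.e. 𝓘_s(a) = a where
  -- 𝓘_s(a)(x) = x^s a(1/x): coefficientwise a_i = a_{s-i} for i ≤ s and
  -- a_i = 0 for i > s.
  Symmetric : ∀ {n} → ℕ → Vec Carrier n → Set ℓ
  Symmetric s a =
    (∀ i → i ℕ.≤ s → coeff a i ≈ coeff a (s ∸ i)) ×
    (∀ i → s ℕ.< i → coeff a i ≈ 0#)

  gammaBasis : (s i : ℕ) → Vec Carrier (i ℕ.+ suc (s ∸ (i ℕ.+ i)))
  gammaBasis s i = shift i (pow onePlusX (s ∸ (i ℕ.+ i)))

  GammaPositive : ∀ {n} → ℕ → Vec Carrier n → Set (c ⊔ ℓ)
  GammaPositive s a =
    Σ (Vec Carrier (suc ⌊ s /2⌋)) λ γ →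
      (∀ i → 0# ≤ᶠ lookup γ i) ×
      (∀ k → coeff a k ≈ sumTo (suc ⌊ s /2⌋) (λ i → coeff γ i * coeff (gammaBasis s i) k))

{-# OPTIONS --safe #-}
module Submission where

-- Let r be the common defect.  A sequence with generating function h(x)/(1-x)ʳ⁺ˢ⁺¹, where h is
-- symmetric with center s/2, is (1-x)⁻ʳ applied to a combination of zⁱwˢ⁻²ⁱ applied to the
-- constant sequence 1, where y = x/(1-x), z = y(1+y) = x/(1-x)² and w = 1+2y = (1+x)/(1-x) act
-- as operators on sequences; γ-positivity says that the coefficients are nonnegative.  Since y is
-- the partial sum operator, a Rota–Baxter operator for the pointwise product, one finds
--   (1-x)⁻ʳf(y)1 · (1-x)⁻ʳg(y)1 = (1-x)⁻ʳ Σₙ zⁿ [aⁿbⁿ] (w+a+b)ʳ f(y+a) g(y+b) 1.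
-- The substitution y ↦ y+a sends w to w+2a and z to z+wa+a², so for f = zⁱwˢ⁻²ⁱ and
-- g = zʲwᵗ⁻²ʲ the right-hand side is a nonnegative combination of the zᵏwᵘ⁻²ᵏ with u = r+s+t.
-- Symmetry of the product follows from the same formula without the sign condition.

open import Defs
open import Level using (Level; _⊔_)
open import Data.Fin as Fin using (toℕ)
open import Data.Nat as ℕ using (ℕ; zero; suc; _∸_; ⌊_/2⌋; z≤n; s≤s)
import Data.Nat.Properties as ℕₚ
open import Data.Product using (Σ; _×_; _,_; proj₁; proj₂)
open import Data.Sum using (inj₁; inj₂)
open import Data.Unit using (⊤; tt)
open import Data.Vec using (Vec; []; _∷_; tabulate; lookup)
open import Relation.Binary.PropositionalEquality as ≡ using (_≡_)
open import Relation.Binary.Structures using (IsTotalOrder)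
open import Relation.Nullary using (yes; no)

module Sequences {c ℓ : Level} (F : OrderedField c ℓ) where
  open OrderedField F hiding (zero)
  open Poly F
  open import Relation.Binary.Reasoning.Setoid setoid
  open import Algebra.Solver.Ring.NaturalCoefficients.Default commutativeSemiring using (solve; _:=_; _:+_; _:*_)
  open import Algebra.Properties.Ring ring using (-1*x≈-x)
  open import Algebra.Properties.Group +-group using () renaming (∙-cancelʳ to +-cancelʳ; ⁻¹-involutive to -‿involutive)

  -- Sequences over the field, the coefficients of formal power series.

  Seq : Set c
  Seq = ℕ → Carrier

  infix  4 _≐_
  infixl 6 _⊕_ _⊖_
  infixl 7 _⊛_ _⊙_

  _≐_ : Seq → Seq → Set ℓ
  f ≐ g = ∀ n → f n ≈ g n

  ≐-sym : ∀ {f g} → f ≐ g → g ≐ f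
  ≐-sym p n = sym (p n)

  ≐-trans : ∀ {f g h} → f ≐ g → g ≐ h → f ≐ h
  ≐-trans p q n = trans (p n) (q n)

  -- Subtraction is addition of a multiple by - 1#, so that linearity of operators covers it
  -- and the semiring solver can treat - 1# as a variable.
  _⊕_ _⊖_ _⊛_ : Seq → Seq → Seq
  (f ⊕ g) n = f n + g n
  (f ⊖ g) n = f n + - 1# * g n
  (f ⊛ g) n = f n * g n

  _⊙_ : Carrier → Seq → Seq
  (a ⊙ f) n = a * f n

  𝟘 𝟙 δ : Seq
  𝟘 _ = 0#
  𝟙 _ = 1#
  δ zero    = 1#
  δ (suc _) = 0#

  x-x≈0 : ∀ x → x + - 1# * x ≈ 0#
  x-x≈0 x = trans (+-congˡ (-1*x≈-x x)) (-‿inverseʳ x)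

  -- Linear operators

  Op : Set c
  Op = Seq → Seq

  record Linear (A : Op) : Set (c ⊔ ℓ) where
    field
      op-cong : ∀ {f g} → f ≐ g → A f ≐ A g
      op-⊕    : ∀ f g → A (f ⊕ g) ≐ A f ⊕ A g
      op-⊙    : ∀ a f → A (a ⊙ f) ≐ a ⊙ A f

    op-⊖ : ∀ f g → A (f ⊖ g) ≐ A f ⊖ A g
    op-⊖ f g n = trans (op-⊕ f (- 1# ⊙ g) n) (+-congˡ (op-⊙ (- 1#) g n))

    op-𝟘 : A 𝟘 ≐ 𝟘
    op-𝟘 n = begin
      A 𝟘 n        ≈⟨ op-cong (λ _ → sym (zeroˡ 0#)) n ⟩
      A (0# ⊙ 𝟘) n ≈⟨ op-⊙ 0# 𝟘 n ⟩
      0# * A 𝟘 n   ≈⟨ zeroˡ _ ⟩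
      0#           ∎

  open Linear

  id-linear : Linear (λ f → f)
  id-linear .op-cong p = p
  id-linear .op-⊕ f g n = refl
  id-linear .op-⊙ a f n = refl

  ∘-linear : ∀ {A B} → Linear A → Linear B → Linear (λ f → A (B f))
  ∘-linear lA lB .op-cong p = op-cong lA (op-cong lB p)
  ∘-linear lA lB .op-⊕ f g = ≐-trans (op-cong lA (op-⊕ lB f g)) (op-⊕ lA _ _)
  ∘-linear lA lB .op-⊙ a f = ≐-trans (op-cong lA (op-⊙ lB a f)) (op-⊙ lA a _)

  ⊕-linear : ∀ {A B} → Linear A → Linear B → Linear (λ f → A f ⊕ B f)
  ⊕-linear lA lB .op-cong p n = +-cong (op-cong lA p n) (op-cong lB p n)
  ⊕-linear lA lB .op-⊕ f g n = trans (+-cong (op-⊕ lA f g n) (op-⊕ lB f g n))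
    (solve 4 (λ a b c d → (a :+ b) :+ (c :+ d) := (a :+ c) :+ (b :+ d)) refl _ _ _ _)
  ⊕-linear lA lB .op-⊙ a f n = trans (+-cong (op-⊙ lA a f n) (op-⊙ lB a f n)) (sym (distribˡ _ _ _))

  ⊙-linear : ∀ {A} a → Linear A → Linear (λ f → a ⊙ A f)
  ⊙-linear a lA .op-cong p n = *-congˡ (op-cong lA p n)
  ⊙-linear a lA .op-⊕ f g n = trans (*-congˡ (op-⊕ lA f g n)) (distribˡ _ _ _)
  ⊙-linear a lA .op-⊙ b f n = trans (*-congˡ (op-⊙ lA b f n))
    (solve 3 (λ a b c → a :* (b :* c) := b :* (a :* c)) refl _ _ _)

  ⊖-linear : ∀ {A B} → Linear A → Linear B → Linear (λ f → A f ⊖ B f)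
  ⊖-linear lA lB = ⊕-linear lA (⊙-linear (- 1#) lB)

  iter : ℕ → Op → Op
  iter zero    A f = f
  iter (suc n) A f = A (iter n A f)

  iter-linear : ∀ {A} n → Linear A → Linear (iter n A)
  iter-linear zero    lA = id-linear
  iter-linear (suc n) lA = ∘-linear lA (iter-linear n lA)

  iter-comm : ∀ {A B : Op} → Linear A → (∀ f → A (B f) ≐ B (A f)) → ∀ n f → iter n A (B f) ≐ B (iter n A f)
  iter-comm lA AB zero    f k = refl
  iter-comm lA AB (suc n) f = ≐-trans (op-cong lA (iter-comm lA AB n f)) (AB _)

  iter-+ : ∀ {A} m n f → iter (m ℕ.+ n) A f ≡ iter m A (iter n A f)
  iter-+ zero    n f = ≡.refl
  iter-+ {A} (suc m) n f = ≡.cong A (iter-+ m n f)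

  iter-inverse : ∀ {A B : Op} → Linear A → (∀ f → A (B f) ≐ f) → ∀ n f → iter n A (iter n B f) ≐ f
  iter-inverse lA AB zero    f k = refl
  iter-inverse {A} {B} lA AB (suc n) f =
    -- The outermost `A` is moved inward past `iter n A`, where it meets the outermost `B` and
    -- cancels.
    ≐-trans (≐-sym (iter-comm {B = A} lA (λ _ _ → refl) n _))
    (≐-trans (op-cong (iter-linear n lA) (AB _)) (iter-inverse lA AB n f))

  -- In terms of generating functions the operators below multiply by
  -- 𝐬 = x, ∇ = 1 - x, 𝐲 = x/(1-x), 𝐩 = 1/(1-x), 𝐰 = (1+x)/(1-x), 𝐳 = x/(1-x)², 𝐯 = 1+x.

  𝐬 𝐯 ∇ 𝐲 𝐩 𝐰 𝐳 : Op
  𝐬 f zero    = 0#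
  𝐬 f (suc n) = f n
  𝐯 f = f ⊕ 𝐬 f
  ∇ f = f ⊖ 𝐬 f
  𝐲 f zero    = 0#
  𝐲 f (suc n) = 𝐲 f n + f n
  𝐩 f = f ⊕ 𝐲 f
  𝐰 f = f ⊕ (𝐲 f ⊕ 𝐲 f)
  𝐳 f = 𝐲 f ⊕ 𝐲 (𝐲 f)

  𝐬-linear : Linear 𝐬
  𝐬-linear .op-cong p zero    = refl
  𝐬-linear .op-cong p (suc n) = p n
  𝐬-linear .op-⊕ f g zero    = sym (+-identityʳ 0#)
  𝐬-linear .op-⊕ f g (suc n) = refl
  𝐬-linear .op-⊙ a f zero    = sym (zeroʳ a)
  𝐬-linear .op-⊙ a f (suc n) = refl

  𝐲-linear : Linear 𝐲
  𝐲-linear .op-cong p zero    = refl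
  𝐲-linear .op-cong p (suc n) = +-cong (op-cong 𝐲-linear p n) (p n)
  𝐲-linear .op-⊕ f g zero    = sym (+-identityʳ 0#)
  𝐲-linear .op-⊕ f g (suc n) = trans (+-congʳ (op-⊕ 𝐲-linear f g n))
    (solve 4 (λ a b c d → (a :+ b) :+ (c :+ d) := (a :+ c) :+ (b :+ d)) refl _ _ _ _)
  𝐲-linear .op-⊙ a f zero    = sym (zeroʳ a)
  𝐲-linear .op-⊙ a f (suc n) = trans (+-congʳ (op-⊙ 𝐲-linear a f n)) (sym (distribˡ _ _ _))

  ∇-linear : Linear ∇
  ∇-linear = ⊖-linear id-linear 𝐬-linear

  𝐩-linear : Linear 𝐩
  𝐩-linear = ⊕-linear id-linear 𝐲-linear

  𝐰-linear : Linear 𝐰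
  𝐰-linear = ⊕-linear id-linear (⊕-linear 𝐲-linear 𝐲-linear)

  𝐳-linear : Linear 𝐳
  𝐳-linear = ⊕-linear 𝐲-linear (∘-linear 𝐲-linear 𝐲-linear)

  -- Relations between the multipliers.

  𝐬𝐩≐𝐲 : ∀ f → 𝐬 (𝐩 f) ≐ 𝐲 f
  𝐬𝐩≐𝐲 f zero    = refl
  𝐬𝐩≐𝐲 f (suc n) = +-comm _ _

  𝐩𝐬≐𝐲 : ∀ f → 𝐩 (𝐬 f) ≐ 𝐲 f
  𝐩𝐬≐𝐲 f zero    = +-identityʳ 0#
  𝐩𝐬≐𝐲 f (suc n) = begin
    f n + (𝐲 (𝐬 f) n + 𝐬 f n) ≈⟨ +-congˡ (+-comm _ _) ⟩
    f n + 𝐩 (𝐬 f) n           ≈⟨ +-congˡ (𝐩𝐬≐𝐲 f n) ⟩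
    f n + 𝐲 f n               ≈⟨ +-comm _ _ ⟩
    𝐲 f n + f n               ∎

  ∇𝐩≐id : ∀ f → ∇ (𝐩 f) ≐ f
  ∇𝐩≐id f n = begin
    (f n + 𝐲 f n) + - 1# * 𝐬 (𝐩 f) n ≈⟨ +-congˡ (*-congˡ (𝐬𝐩≐𝐲 f n)) ⟩
    (f n + 𝐲 f n) + - 1# * 𝐲 f n     ≈⟨ +-assoc _ _ _ ⟩
    f n + (𝐲 f n + - 1# * 𝐲 f n)     ≈⟨ +-congˡ (x-x≈0 _) ⟩
    f n + 0#                         ≈⟨ +-identityʳ _ ⟩
    f n                              ∎

  𝐩∇≐id : ∀ f → 𝐩 (∇ f) ≐ f
  𝐩∇≐id f n = begin
    𝐩 (∇ f) n                  ≈⟨ op-⊖ 𝐩-linear f (𝐬 f) n ⟩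
    (𝐩 f ⊖ 𝐩 (𝐬 f)) n          ≈⟨ +-congˡ (*-congˡ (𝐩𝐬≐𝐲 f n)) ⟩
    (f n + 𝐲 f n) + - 1# * 𝐲 f n ≈⟨ +-assoc _ _ _ ⟩
    f n + (𝐲 f n + - 1# * 𝐲 f n) ≈⟨ +-congˡ (x-x≈0 _) ⟩
    f n + 0#                   ≈⟨ +-identityʳ _ ⟩
    f n                        ∎

  𝐩𝐯≐𝐰 : ∀ f → 𝐩 (𝐯 f) ≐ 𝐰 f
  𝐩𝐯≐𝐰 f n = begin
    𝐩 (𝐯 f) n               ≈⟨ op-⊕ 𝐩-linear f (𝐬 f) n ⟩
    (f n + 𝐲 f n) + 𝐩 (𝐬 f) n ≈⟨ +-congˡ (𝐩𝐬≐𝐲 f n) ⟩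
    (f n + 𝐲 f n) + 𝐲 f n   ≈⟨ +-assoc _ _ _ ⟩
    𝐰 f n                   ∎

  𝐩𝐩𝐬≐𝐳 : ∀ f → 𝐩 (𝐩 (𝐬 f)) ≐ 𝐳 f
  𝐩𝐩𝐬≐𝐳 f = op-cong 𝐩-linear (𝐩𝐬≐𝐲 f)

  𝐩𝐯-comm : ∀ f → 𝐩 (𝐯 f) ≐ 𝐯 (𝐩 f)
  𝐩𝐯-comm f n = begin
    𝐩 (𝐯 f) n             ≈⟨ op-⊕ 𝐩-linear f (𝐬 f) n ⟩
    𝐩 f n + 𝐩 (𝐬 f) n     ≈⟨ +-congˡ (trans (𝐩𝐬≐𝐲 f n) (sym (𝐬𝐩≐𝐲 f n))) ⟩
    𝐯 (𝐩 f) n             ∎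

  𝐩𝐬-comm : ∀ f → 𝐩 (𝐬 f) ≐ 𝐬 (𝐩 f)
  𝐩𝐬-comm f n = trans (𝐩𝐬≐𝐲 f n) (sym (𝐬𝐩≐𝐲 f n))

  𝐩𝐲-comm : ∀ f → 𝐩 (𝐲 f) ≐ 𝐲 (𝐩 f)
  𝐩𝐲-comm f n = sym (op-⊕ 𝐲-linear f (𝐲 f) n)

  𝐰𝐩-comm : ∀ f → 𝐰 (𝐩 f) ≐ 𝐩 (𝐰 f)
  𝐰𝐩-comm f n = sym (begin
    𝐩 (𝐰 f) n                           ≈⟨ op-⊕ 𝐩-linear f (𝐲 f ⊕ 𝐲 f) n ⟩
    𝐩 f n + 𝐩 (𝐲 f ⊕ 𝐲 f) n             ≈⟨ +-congˡ (op-⊕ 𝐩-linear (𝐲 f) (𝐲 f) n) ⟩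
    𝐩 f n + (𝐩 (𝐲 f) n + 𝐩 (𝐲 f) n)     ≈⟨ +-congˡ (+-cong (𝐩𝐲-comm f n) (𝐩𝐲-comm f n)) ⟩
    𝐰 (𝐩 f) n                           ∎)

  𝐲δ-suc : ∀ n → 𝐲 δ (suc n) ≈ 1#
  𝐲δ-suc zero    = +-identityˡ 1#
  𝐲δ-suc (suc n) = trans (+-identityʳ _) (𝐲δ-suc n)

  𝐩δ≐𝟙 : 𝐩 δ ≐ 𝟙
  𝐩δ≐𝟙 zero    = +-identityʳ 1#
  𝐩δ≐𝟙 (suc n) = trans (+-identityˡ _) (𝐲δ-suc n)

  -- Since w = (1+x)/(1-x), applying `𝐰` multiplies the numerator by 1+x and adds one factor 1-x to
  -- the denominator. Likewise `𝐳` contributes x and two such factors, so the denominator exponent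
  -- stays one above the degree.
  𝐰-iter : ∀ s h → 𝐰 (iter (suc s) 𝐩 h) ≐ iter (suc (suc s)) 𝐩 (𝐯 h)
  𝐰-iter s h = ≐-trans (≐-sym (𝐩𝐯≐𝐰 _))
    (op-cong 𝐩-linear (≐-sym (iter-comm {B = 𝐯} 𝐩-linear 𝐩𝐯-comm (suc s) h)))

  𝐳-iter : ∀ s h → 𝐳 (iter (suc s) 𝐩 h) ≐ iter (suc (suc (suc s))) 𝐩 (𝐬 h)
  𝐳-iter s h = ≐-trans (≐-sym (𝐩𝐩𝐬≐𝐳 _))
    (op-cong (∘-linear 𝐩-linear 𝐩-linear) (≐-sym (iter-comm {B = 𝐬} 𝐩-linear 𝐩𝐬-comm (suc s) h)))

  iter-𝐩-linear : ∀ n → Linear (iter n 𝐩)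
  iter-𝐩-linear n = iter-linear n 𝐩-linear

  -- Cones

  module _ {p : Level} (P : Carrier → Set p) where

    -- The index is the degree: `A` counts 1 and `B` counts 2. The predicate `P` restricts the
    -- scalars, so one induction serves both symmetry (all scalars) and γ-positivity (nonnegative
    -- ones). Closure under `≐` is a constructor because operators are compared only pointwise.
    data Cone (e : Seq) (A B : Op) : ℕ → Seq → Set (c ⊔ ℓ ⊔ p) where
      zero-in  : ∀ {s} → Cone e A B s 𝟘
      unit-in  : Cone e A B 0 e
      A-in     : ∀ {s f} → Cone e A B s f → Cone e A B (suc s) (A f)
      B-in     : ∀ {s f} → Cone e A B s f → Cone e A B (suc (suc s)) (B f)
      ⊕-in     : ∀ {s f g} → Cone e A B s f → Cone e A B s g → Cone e A B s (f ⊕ g)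
      ⊙-in     : ∀ {s f a} → P a → Cone e A B s f → Cone e A B s (a ⊙ f)
      ≐-in     : ∀ {s f g} → f ≐ g → Cone e A B s f → Cone e A B s g

    -- 𝐂 s is spanned by the sequences with generating functions
    -- xⁱ(1+x)ˢ⁻²ⁱ/(1-x)ˢ⁺¹, and 𝐇 s by their numerators.
    𝐂 𝐇 : ℕ → Seq → Set (c ⊔ ℓ ⊔ p)
    𝐂 = Cone 𝟙 𝐰 𝐳
    𝐇 = Cone δ 𝐯 𝐬

    -- Division by (1-x)ˢ⁺¹ carries the generators δ, `𝐯`, `𝐬` to 𝟙, `𝐰`, `𝐳`; linearity covers the
    -- remaining constructors. The converse below recovers the numerator.
    𝐇⇒𝐂 : ∀ {s h} → 𝐇 s h → 𝐂 s (iter (suc s) 𝐩 h)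
    𝐇⇒𝐂 {s} zero-in    = ≐-in (≐-sym (op-𝟘 (iter-𝐩-linear (suc s)))) zero-in
    𝐇⇒𝐂 unit-in        = ≐-in (≐-sym 𝐩δ≐𝟙) unit-in
    𝐇⇒𝐂 (A-in {s} {h} x) = ≐-in (𝐰-iter s h) (A-in (𝐇⇒𝐂 x))
    𝐇⇒𝐂 (B-in {s} {h} x) = ≐-in (𝐳-iter s h) (B-in (𝐇⇒𝐂 x))
    𝐇⇒𝐂 {s} (⊕-in x y) = ≐-in (≐-sym (op-⊕ (iter-𝐩-linear (suc s)) _ _)) (⊕-in (𝐇⇒𝐂 x) (𝐇⇒𝐂 y))
    𝐇⇒𝐂 {s} (⊙-in a x) = ≐-in (≐-sym (op-⊙ (iter-𝐩-linear (suc s)) _ _)) (⊙-in a (𝐇⇒𝐂 x))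
    𝐇⇒𝐂 {s} (≐-in q x) = ≐-in (op-cong (iter-𝐩-linear (suc s)) q) (𝐇⇒𝐂 x)

    𝐂⇒𝐇 : ∀ {s f} → 𝐂 s f → Σ Seq λ h → 𝐇 s h × f ≐ iter (suc s) 𝐩 h
    𝐂⇒𝐇 {s} zero-in = 𝟘 , zero-in , ≐-sym (op-𝟘 (iter-𝐩-linear (suc s)))
    𝐂⇒𝐇 unit-in = δ , unit-in , ≐-sym 𝐩δ≐𝟙
    𝐂⇒𝐇 (A-in {s} x) with h , hx , eq ← 𝐂⇒𝐇 x =
      𝐯 h , A-in hx , ≐-trans (op-cong 𝐰-linear eq) (𝐰-iter s h)
    𝐂⇒𝐇 (B-in {s} x) with h , hx , eq ← 𝐂⇒𝐇 x =
      𝐬 h , B-in hx , ≐-trans (op-cong 𝐳-linear eq) (𝐳-iter s h)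
    𝐂⇒𝐇 {s} (⊕-in x y) with h , hx , eq ← 𝐂⇒𝐇 x | k , ky , eq′ ← 𝐂⇒𝐇 y =
      h ⊕ k , ⊕-in hx ky , λ n → trans (+-cong (eq n) (eq′ n)) (sym (op-⊕ (iter-𝐩-linear (suc s)) h k n))
    𝐂⇒𝐇 {s} (⊙-in {a = a} pa x) with h , hx , eq ← 𝐂⇒𝐇 x =
      a ⊙ h , ⊙-in pa hx , λ n → trans (*-congˡ (eq n)) (sym (op-⊙ (iter-𝐩-linear (suc s)) a h n))
    𝐂⇒𝐇 (≐-in q x) with h , hx , eq ← 𝐂⇒𝐇 x = h , hx , ≐-trans (≐-sym q) eq

  -- Products

  -- Write f = f(𝐲)𝟙 and g = g(𝐲)𝟙.  Then Φ m n f g corresponds to aᵐbⁿ f(𝐲 + a) g(𝐲 + b),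
  -- where a and b are the differences between 𝐲 acting on one factor of a
  -- pointwise product and 𝐲 acting on the whole product.
  Φ : ℕ → ℕ → Seq → Seq → Seq
  Φ zero    zero    f g = f ⊛ g
  Φ zero    (suc n) f g = Φ zero n f (𝐲 g) ⊖ 𝐲 (Φ zero n f g)
  Φ (suc m) n       f g = Φ m n (𝐲 f) g ⊖ 𝐲 (Φ m n f g)

  Φ-linearˡ : ∀ m n g → Linear (λ f → Φ m n f g)
  Φ-linearˡ zero zero g .op-cong p k = *-congʳ (p k)
  Φ-linearˡ zero zero g .op-⊕ f f′ k = distribʳ _ _ _
  Φ-linearˡ zero zero g .op-⊙ a f k = *-assoc _ _ _
  Φ-linearˡ zero (suc n) g = ⊖-linear (Φ-linearˡ zero n (𝐲 g)) (∘-linear 𝐲-linear (Φ-linearˡ zero n g))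
  Φ-linearˡ (suc m) n g = ⊖-linear (∘-linear (Φ-linearˡ m n g) 𝐲-linear) (∘-linear 𝐲-linear (Φ-linearˡ m n g))

  Φ-linearʳ : ∀ m n f → Linear (Φ m n f)
  Φ-linearʳ zero zero f .op-cong p k = *-congˡ (p k)
  Φ-linearʳ zero zero f .op-⊕ g g′ k = distribˡ _ _ _
  Φ-linearʳ zero zero f .op-⊙ a g k = solve 3 (λ a b c → a :* (b :* c) := b :* (a :* c)) refl _ _ _
  Φ-linearʳ zero (suc n) f = ⊖-linear (∘-linear (Φ-linearʳ zero n f) 𝐲-linear) (∘-linear 𝐲-linear (Φ-linearʳ zero n f))
  Φ-linearʳ (suc m) n f = ⊖-linear (Φ-linearʳ m n (𝐲 f)) (∘-linear 𝐲-linear (Φ-linearʳ m n f))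

  y+[x-y]≈x : ∀ x y → y + (x + - 1# * y) ≈ x
  y+[x-y]≈x x y = begin
    y + (x + - 1# * y) ≈⟨ solve 3 (λ k x y → y :+ (x :+ k :* y) := x :+ (y :+ k :* y)) refl _ _ _ ⟩
    x + (y + - 1# * y) ≈⟨ +-congˡ (x-x≈0 y) ⟩
    x + 0#             ≈⟨ +-identityʳ x ⟩
    x                  ∎

  Φ-𝐲ˡ : ∀ m n f g → Φ m n (𝐲 f) g ≐ 𝐲 (Φ m n f g) ⊕ Φ (suc m) n f g
  Φ-𝐲ˡ m n f g k = sym (y+[x-y]≈x _ _)

  -- `Φ` recurses on `m` first, so the recurrence in `n` is immediate only at `m` = 0. For larger
  -- `m` both sides are differences, which linearity of `𝐲` regroups.
  Φ-𝐲ʳ : ∀ m n f g → Φ m n f (𝐲 g) ≐ 𝐲 (Φ m n f g) ⊕ Φ m (suc n) f g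
  Φ-𝐲ʳ zero    n f g k = sym (y+[x-y]≈x _ _)
  Φ-𝐲ʳ (suc m) n f g k = begin
    Φ m n (𝐲 f) (𝐲 g) k + - 1# * 𝐲 (Φ m n f (𝐲 g)) k
      ≈⟨ +-cong (Φ-𝐲ʳ m n (𝐲 f) g k)
                (*-congˡ (trans (op-cong 𝐲-linear (Φ-𝐲ʳ m n f g) k) (op-⊕ 𝐲-linear _ _ k))) ⟩
    (𝐲 (Φ m n (𝐲 f) g) k + Φ m (suc n) (𝐲 f) g k) + - 1# * (𝐲 (𝐲 (Φ m n f g)) k + 𝐲 (Φ m (suc n) f g) k)
      ≈⟨ solve 5 (λ a b c d e → (a :+ b) :+ e :* (c :+ d) := (a :+ e :* c) :+ (b :+ e :* d)) refl _ _ _ _ _ ⟩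
    (𝐲 (Φ m n (𝐲 f) g) ⊖ 𝐲 (𝐲 (Φ m n f g))) k + Φ (suc m) (suc n) f g k
      ≈⟨ +-congʳ (op-⊖ 𝐲-linear _ _ k) ⟨
    𝐲 (Φ (suc m) n f g) k + Φ (suc m) (suc n) f g k ∎

  -- `𝐲 f n` sums f over the indices below n. A double sum over i, j < n splits into the parts i =
  -- j, i < j and j < i.
  𝐲-rotaBaxter : ∀ f g → 𝐲 f ⊛ 𝐲 g ≐ 𝐲 (f ⊛ g ⊕ (𝐲 f ⊛ g ⊕ f ⊛ 𝐲 g))
  𝐲-rotaBaxter f g zero    = zeroˡ _
  𝐲-rotaBaxter f g (suc n) = trans
    (solve 4 (λ a b c d → (a :+ b) :* (c :+ d) := a :* c :+ (b :* d :+ (a :* d :+ b :* c))) refl _ _ _ _)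
    (+-congʳ (𝐲-rotaBaxter f g n))

  ⊖-interchange : ∀ f₁ f₂ f₃ g₁ g₂ g₃ →
    𝐲 (f₁ ⊕ (f₂ ⊕ f₃)) ⊖ 𝐲 (𝐲 (g₁ ⊕ (g₂ ⊕ g₃))) ≐ 𝐲 ((f₁ ⊖ 𝐲 g₁) ⊕ ((f₂ ⊖ 𝐲 g₂) ⊕ (f₃ ⊖ 𝐲 g₃)))
  ⊖-interchange f₁ f₂ f₃ g₁ g₂ g₃ k = begin
    (𝐲 (f₁ ⊕ (f₂ ⊕ f₃)) ⊖ 𝐲 (𝐲 (g₁ ⊕ (g₂ ⊕ g₃)))) k
      ≈⟨ op-⊖ 𝐲-linear _ _ k ⟨
    𝐲 ((f₁ ⊕ (f₂ ⊕ f₃)) ⊖ 𝐲 (g₁ ⊕ (g₂ ⊕ g₃))) k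
      ≈⟨ op-cong 𝐲-linear (λ n → trans
           (+-congˡ (*-congˡ (trans (op-⊕ 𝐲-linear g₁ (g₂ ⊕ g₃) n) (+-congˡ (op-⊕ 𝐲-linear g₂ g₃ n)))))
           (solve 7 (λ a b c e x y z → (a :+ (b :+ c)) :+ e :* (x :+ (y :+ z))
                     := (a :+ e :* x) :+ ((b :+ e :* y) :+ (c :+ e :* z))) refl _ _ _ _ _ _ _)) k ⟩
    𝐲 ((f₁ ⊖ 𝐲 g₁) ⊕ ((f₂ ⊖ 𝐲 g₂) ⊕ (f₃ ⊖ 𝐲 g₃))) k ∎

  -- `Φ` is built from the pointwise product by applying `𝐲` to an argument and subtracting `𝐲` of
  -- the whole; both operations preserve the Rota-Baxter identity.
  Φ-rotaBaxter : ∀ m n f g → Φ m n (𝐲 f) (𝐲 g) ≐ 𝐲 (Φ m n f g ⊕ (Φ m n (𝐲 f) g ⊕ Φ m n f (𝐲 g)))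
  Φ-rotaBaxter zero zero f g = 𝐲-rotaBaxter f g
  Φ-rotaBaxter zero (suc n) f g k = trans
    (+-cong (Φ-rotaBaxter zero n f (𝐲 g) k) (*-congˡ (op-cong 𝐲-linear (Φ-rotaBaxter zero n f g) k)))
    (⊖-interchange _ _ _ (Φ zero n f g) (Φ zero n (𝐲 f) g) (Φ zero n f (𝐲 g)) k)
  Φ-rotaBaxter (suc m) n f g k = trans
    (+-cong (Φ-rotaBaxter m n (𝐲 f) g k) (*-congˡ (op-cong 𝐲-linear (Φ-rotaBaxter m n f g) k)))
    (⊖-interchange _ _ _ (Φ m n f g) (Φ m n (𝐲 f) g) (Φ m n f (𝐲 g)) k)

  -- In terms of a and b: 1 + (y+a) + (y+b) = w + a + b.
  Φ-unmixed : ∀ m n f g → Φ m n f g ⊕ (Φ m n (𝐲 f) g ⊕ Φ m n f (𝐲 g))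
            ≐ 𝐰 (Φ m n f g) ⊕ (Φ (suc m) n f g ⊕ Φ m (suc n) f g)
  Φ-unmixed m n f g k = trans (+-congˡ (+-cong (Φ-𝐲ˡ m n f g k) (Φ-𝐲ʳ m n f g k)))
    (solve 4 (λ a b c d → a :+ ((b :+ c) :+ (b :+ d)) := (a :+ (b :+ b)) :+ (c :+ d)) refl _ _ _ _)

  -- ab = 𝐳
  Φ-suc-suc : ∀ m n f g → Φ (suc m) (suc n) f g ≐ 𝐳 (Φ m n f g)
  -- Expand (y+a)(y+b) directly as y² + ya + yb + ab and by Rota-Baxter as y(w+a+b). Cancelling y² +
  -- ya + yb leaves ab = yw - y² = y + y².
  Φ-suc-suc m n f g k = +-cancelʳ (𝐲 (𝐲 h) k + (𝐲 hˡ k + 𝐲 hʳ k)) _ _ (begin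
    Φ (suc m) (suc n) f g k + (𝐲 (𝐲 h) k + (𝐲 hˡ k + 𝐲 hʳ k))
      ≈⟨ solve 4 (λ a b c d → a :+ (b :+ (c :+ d)) := (b :+ d) :+ (c :+ a)) refl _ _ _ _ ⟩
    (𝐲 (𝐲 h) k + 𝐲 hʳ k) + (𝐲 hˡ k + Φ (suc m) (suc n) f g k)
      ≈⟨ +-cong (trans (op-cong 𝐲-linear (Φ-𝐲ʳ m n f g) k) (op-⊕ 𝐲-linear _ _ k)) (Φ-𝐲ʳ (suc m) n f g k) ⟨
    𝐲 (Φ m n f (𝐲 g)) k + Φ (suc m) n f (𝐲 g) k
      ≈⟨ Φ-𝐲ˡ m n f (𝐲 g) k ⟨
    Φ m n (𝐲 f) (𝐲 g) k
      ≈⟨ Φ-rotaBaxter m n f g k ⟩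
    𝐲 (h ⊕ (Φ m n (𝐲 f) g ⊕ Φ m n f (𝐲 g))) k
      ≈⟨ op-cong 𝐲-linear (Φ-unmixed m n f g) k ⟩
    𝐲 (𝐰 h ⊕ (hˡ ⊕ hʳ)) k
      ≈⟨ trans (op-⊕ 𝐲-linear _ _ k) (+-cong (trans (op-⊕ 𝐲-linear _ _ k) (+-congˡ (op-⊕ 𝐲-linear _ _ k))) (op-⊕ 𝐲-linear _ _ k)) ⟩
    (𝐲 h k + (𝐲 (𝐲 h) k + 𝐲 (𝐲 h) k)) + (𝐲 hˡ k + 𝐲 hʳ k)
      ≈⟨ solve 4 (λ a b c d → (a :+ (b :+ b)) :+ (c :+ d) := (a :+ b) :+ (b :+ (c :+ d))) refl _ _ _ _ ⟩
    𝐳 h k + (𝐲 (𝐲 h) k + (𝐲 hˡ k + 𝐲 hʳ k)) ∎)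
    where
    h hˡ hʳ : Seq
    h  = Φ m n f g
    hˡ = Φ (suc m) n f g
    hʳ = Φ m (suc n) f g

  ⊖-𝐲-vanish : ∀ {f g} → f ≐ 𝟘 → g ≐ 𝟘 → f ⊖ 𝐲 g ≐ 𝟘
  ⊖-𝐲-vanish p q k = trans (+-cong (p k) (trans (*-congˡ (trans (op-cong 𝐲-linear q k) (op-𝟘 𝐲-linear k))) (zeroʳ _))) (+-identityʳ 0#)

  -- When the other factor is the constant 𝟙, summing one factor is the same as summing the product,
  -- so a acts as zero. The mirror statement for b follows.
  Φ-𝟙ʳ : ∀ m f → Φ (suc m) 0 f 𝟙 ≐ 𝟘
  Φ-𝟙ʳ zero    f k = trans (+-cong (*-identityʳ _) (*-congˡ (op-cong 𝐲-linear (λ n → *-identityʳ (f n)) k))) (x-x≈0 _)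
  Φ-𝟙ʳ (suc m) f   = ⊖-𝐲-vanish (Φ-𝟙ʳ m (𝐲 f)) (Φ-𝟙ʳ m f)

  Φ-𝟙ˡ : ∀ n g → Φ 0 (suc n) 𝟙 g ≐ 𝟘
  Φ-𝟙ˡ zero    g k = trans (+-cong (*-identityˡ _) (*-congˡ (op-cong 𝐲-linear (λ n → *-identityˡ (g n)) k))) (x-x≈0 _)
  Φ-𝟙ˡ (suc n) g   = ⊖-𝐲-vanish (Φ-𝟙ˡ n (𝐲 g)) (Φ-𝟙ˡ n g)

  -- With X = w + a + b, (1+y+a)(1+y+b) = X + (y+a)(y+b) = X + yX. Thus one `𝐩` on each factor
  -- becomes a single `𝐩` on the product, at the price of a factor X.
  Φ-𝐩𝐩 : ∀ m n f g → Φ m n (𝐩 f) (𝐩 g) ≐ 𝐩 (𝐰 (Φ m n f g) ⊕ (Φ (suc m) n f g ⊕ Φ m (suc n) f g))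
  Φ-𝐩𝐩 m n f g k = begin
    Φ m n (𝐩 f) (𝐩 g) k
      ≈⟨ op-⊕ (Φ-linearˡ m n (𝐩 g)) f (𝐲 f) k ⟩
    Φ m n f (𝐩 g) k + Φ m n (𝐲 f) (𝐩 g) k
      ≈⟨ +-cong (op-⊕ (Φ-linearʳ m n f) g (𝐲 g) k) (op-⊕ (Φ-linearʳ m n (𝐲 f)) g (𝐲 g) k) ⟩
    (Φ m n f g k + Φ m n f (𝐲 g) k) + (Φ m n (𝐲 f) g k + Φ m n (𝐲 f) (𝐲 g) k)
      ≈⟨ solve 4 (λ a b c d → (a :+ b) :+ (c :+ d) := (a :+ (c :+ b)) :+ d) refl _ _ _ _ ⟩
    (Φ m n f g k + (Φ m n (𝐲 f) g k + Φ m n f (𝐲 g) k)) + Φ m n (𝐲 f) (𝐲 g) k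
      ≈⟨ +-congˡ (Φ-rotaBaxter m n f g k) ⟩
    𝐩 (Φ m n f g ⊕ (Φ m n (𝐲 f) g ⊕ Φ m n f (𝐲 g))) k
      ≈⟨ op-cong 𝐩-linear (Φ-unmixed m n f g) k ⟩
    𝐩 (𝐰 (Φ m n f g) ⊕ (Φ (suc m) n f g ⊕ Φ m (suc n) f g)) k ∎

  -- Closure of the cones under products.

  module _ {p : Level} (P : Carrier → Set p) where

    cast : ∀ {s t f} → s ≡ t → 𝐂 P s f → 𝐂 P t f
    cast ≡.refl x = x

    -- B m f stands for aᵐ f(𝐲 + a); thus 𝐰 and 𝐳 become 𝐰 + 2a and 𝐳 + 𝐰a + a²,
    -- with nonnegative coefficients and of the same degree when a has degree 1.
    module _ (B : ℕ → Op) (B-linear : ∀ m → Linear (B m))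
             (B-𝐲 : ∀ m f → B m (𝐲 f) ≐ 𝐲 (B m f) ⊕ B (suc m) f) where

      B-𝐰 : ∀ m f → B m (𝐰 f) ≐ 𝐰 (B m f) ⊕ (B (suc m) f ⊕ B (suc m) f)
      B-𝐰 m f k = begin
        B m (𝐰 f) k
          ≈⟨ trans (op-⊕ (B-linear m) _ _ k) (+-congˡ (op-⊕ (B-linear m) _ _ k)) ⟩
        B m f k + (B m (𝐲 f) k + B m (𝐲 f) k)
          ≈⟨ +-congˡ (+-cong (B-𝐲 m f k) (B-𝐲 m f k)) ⟩
        B m f k + ((𝐲 (B m f) k + B (suc m) f k) + (𝐲 (B m f) k + B (suc m) f k))
          ≈⟨ solve 3 (λ a b c → a :+ ((b :+ c) :+ (b :+ c)) := (a :+ (b :+ b)) :+ (c :+ c)) refl _ _ _ ⟩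
        (𝐰 (B m f) ⊕ (B (suc m) f ⊕ B (suc m) f)) k ∎

      B-𝐳 : ∀ m f → B m (𝐳 f) ≐ 𝐳 (B m f) ⊕ (𝐰 (B (suc m) f) ⊕ B (suc (suc m)) f)
      B-𝐳 m f k = begin
        B m (𝐳 f) k
          ≈⟨ op-⊕ (B-linear m) _ _ k ⟩
        B m (𝐲 f) k + B m (𝐲 (𝐲 f)) k
          ≈⟨ +-cong (B-𝐲 m f k) (B-𝐲 m (𝐲 f) k) ⟩
        (𝐲 (B m f) k + B (suc m) f k) + (𝐲 (B m (𝐲 f)) k + B (suc m) (𝐲 f) k)
          ≈⟨ +-congˡ (+-cong (trans (op-cong 𝐲-linear (B-𝐲 m f) k) (op-⊕ 𝐲-linear _ _ k)) (B-𝐲 (suc m) f k)) ⟩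
        (𝐲 (B m f) k + B (suc m) f k) +
        ((𝐲 (𝐲 (B m f)) k + 𝐲 (B (suc m) f) k) + (𝐲 (B (suc m) f) k + B (suc (suc m)) f k))
          ≈⟨ solve 5 (λ a b c d e → (a :+ b) :+ ((c :+ d) :+ (d :+ e))
                      := (a :+ c) :+ ((b :+ (d :+ d)) :+ e)) refl _ _ _ _ _ ⟩
        (𝐳 (B m f) ⊕ (𝐰 (B (suc m) f) ⊕ B (suc (suc m)) f)) k ∎

      -- Induction on membership, for all `m` at once because expanding `𝐰` and `𝐳` raises the power
      -- of a by up to 1 and 2. `K` is the degree already contributed by the fixed data in `B`.
      B-𝐂 : ∀ {K} → (∀ m → 𝐂 P (K ℕ.+ m) (B m 𝟙)) →
            ∀ {s f} → 𝐂 P s f → ∀ m → 𝐂 P (s ℕ.+ (K ℕ.+ m)) (B m f)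
      B-𝐂 {K} base = go
        where
        shift₁ : ∀ s m → s ℕ.+ (K ℕ.+ suc m) ≡ suc (s ℕ.+ (K ℕ.+ m))
        shift₁ s m = ≡.trans (≡.cong (s ℕ.+_) (ℕₚ.+-suc K m)) (ℕₚ.+-suc s (K ℕ.+ m))

        go : ∀ {s f} → 𝐂 P s f → ∀ m → 𝐂 P (s ℕ.+ (K ℕ.+ m)) (B m f)
        go zero-in m = ≐-in (≐-sym (op-𝟘 (B-linear m))) zero-in
        go unit-in m = base m
        go (A-in {s} {f} x) m = ≐-in (≐-sym (B-𝐰 m f)) (⊕-in (A-in (go x m)) (⊕-in x′ x′))
          where x′ = cast (shift₁ s m) (go x (suc m))
        go (B-in {s} {f} x) m = ≐-in (≐-sym (B-𝐳 m f)) (⊕-in (B-in (go x m)) (⊕-in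
          (A-in (cast (shift₁ s m) (go x (suc m))))
          (cast (≡.trans (shift₁ s (suc m)) (≡.cong suc (shift₁ s m))) (go x (suc (suc m))))))
        go (⊕-in x y) m = ≐-in (≐-sym (op-⊕ (B-linear m) _ _)) (⊕-in (go x m) (go y m))
        go (⊙-in a x) m = ≐-in (≐-sym (op-⊙ (B-linear m) _ _)) (⊙-in a (go x m))
        go (≐-in q x) m = ≐-in (op-cong (B-linear m) q) (go x m)

    -- Pairs ab leave as `𝐳`, and a remaining pure power of a or b annihilates 𝟙. So only m = n
    -- survives, which is the coefficient extraction [aⁿbⁿ].
    Φ-𝟙𝟙-𝐂 : ∀ m n → 𝐂 P (m ℕ.+ n) (Φ m n 𝟙 𝟙)
    Φ-𝟙𝟙-𝐂 zero    zero    = ≐-in (λ _ → sym (*-identityˡ 1#)) unit-in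
    Φ-𝟙𝟙-𝐂 zero    (suc n) = ≐-in (≐-sym (Φ-𝟙ˡ n 𝟙)) zero-in
    Φ-𝟙𝟙-𝐂 (suc m) zero    = ≐-in (≐-sym (Φ-𝟙ʳ m 𝟙)) zero-in
    Φ-𝟙𝟙-𝐂 (suc m) (suc n) = cast (≡.cong suc (≡.sym (ℕₚ.+-suc m n)))
      (≐-in (≐-sym (Φ-suc-suc m n 𝟙 𝟙)) (B-in (Φ-𝟙𝟙-𝐂 m n)))

    Φ-𝐂 : ∀ {s t f g} → 𝐂 P s f → 𝐂 P t g → ∀ m n → 𝐂 P (s ℕ.+ ((t ℕ.+ n) ℕ.+ m)) (Φ m n f g)
    Φ-𝐂 {t = t} {g = g} x y m n =
      -- The outer induction expands f(y+a) with `g` fixed. Its base case f = 𝟙 is an inner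
      -- induction expanding g(y+b), which ends at `Φ-𝟙𝟙-𝐂`.
      B-𝐂 (λ m f → Φ m n f g) (λ m → Φ-linearˡ m n g) (λ m f → Φ-𝐲ˡ m n f g)
        (λ m → cast (≡.trans (≡.cong (t ℕ.+_) (ℕₚ.+-comm m n)) (≡.sym (ℕₚ.+-assoc t n m)))
          (B-𝐂 (λ n g → Φ m n 𝟙 g) (λ n → Φ-linearʳ m n 𝟙) (λ n g → Φ-𝐲ʳ m n 𝟙 g)
            (λ n → Φ-𝟙𝟙-𝐂 m n) y n))
        x m

    -- Each `𝐩` peeled off both factors yields w + a + b, hence three induction hypotheses, at
    -- (m,n), (m+1,n) and (m,n+1); all three terms have degree one higher. Iterating produces
    -- (w+a+b)ʳ.
    Φ-iter-𝐩 : ∀ {s t f g} → 𝐂 P s f → 𝐂 P t g → ∀ r m n →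
      Σ Seq λ h → 𝐂 P (r ℕ.+ (s ℕ.+ ((t ℕ.+ n) ℕ.+ m))) h × Φ m n (iter r 𝐩 f) (iter r 𝐩 g) ≐ iter r 𝐩 h
    Φ-iter-𝐩 x y zero m n = _ , Φ-𝐂 x y m n , λ _ → refl
    Φ-iter-𝐩 {s} {t} {f} {g} x y (suc r) m n
      with h₀ , x₀ , eq₀ ← Φ-iter-𝐩 x y r m n
         | h₁ , x₁ , eq₁ ← Φ-iter-𝐩 x y r (suc m) n
         | h₂ , x₂ , eq₂ ← Φ-iter-𝐩 x y r m (suc n) =
      𝐰 h₀ ⊕ (h₁ ⊕ h₂) ,
      ⊕-in (A-in x₀) (⊕-in (cast deg₁ x₁) (cast deg₂ x₂)) ,
      λ k → begin
        Φ m n (𝐩 (iter r 𝐩 f)) (𝐩 (iter r 𝐩 g)) k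
          ≈⟨ Φ-𝐩𝐩 m n (iter r 𝐩 f) (iter r 𝐩 g) k ⟩
        𝐩 (𝐰 (Φ m n fᵣ gᵣ) ⊕ (Φ (suc m) n fᵣ gᵣ ⊕ Φ m (suc n) fᵣ gᵣ)) k
          ≈⟨ op-cong 𝐩-linear (λ i → +-cong (op-cong 𝐰-linear eq₀ i) (+-cong (eq₁ i) (eq₂ i))) k ⟩
        𝐩 (𝐰 (iter r 𝐩 h₀) ⊕ (iter r 𝐩 h₁ ⊕ iter r 𝐩 h₂)) k
          ≈⟨ op-cong 𝐩-linear (λ i → +-cong
               (iter-comm {B = 𝐰} 𝐩-linear (λ f → ≐-sym (𝐰𝐩-comm f)) r h₀ i)
               (op-⊕ (iter-linear r 𝐩-linear) h₁ h₂ i)) k ⟨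
        𝐩 (iter r 𝐩 (𝐰 h₀) ⊕ iter r 𝐩 (h₁ ⊕ h₂)) k
          ≈⟨ op-cong 𝐩-linear (op-⊕ (iter-linear r 𝐩-linear) (𝐰 h₀) (h₁ ⊕ h₂)) k ⟨
        𝐩 (iter r 𝐩 (𝐰 h₀ ⊕ (h₁ ⊕ h₂))) k ∎
      where
      fᵣ gᵣ : Seq
      fᵣ = iter r 𝐩 f
      gᵣ = iter r 𝐩 g

      deg₁ : r ℕ.+ (s ℕ.+ ((t ℕ.+ n) ℕ.+ suc m)) ≡ suc (r ℕ.+ (s ℕ.+ ((t ℕ.+ n) ℕ.+ m)))
      deg₁ = ≡.trans (≡.cong (λ i → r ℕ.+ (s ℕ.+ i)) (ℕₚ.+-suc (t ℕ.+ n) m))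
        (≡.trans (≡.cong (r ℕ.+_) (ℕₚ.+-suc s _)) (ℕₚ.+-suc r _))

      deg₂ : r ℕ.+ (s ℕ.+ ((t ℕ.+ suc n) ℕ.+ m)) ≡ suc (r ℕ.+ (s ℕ.+ ((t ℕ.+ n) ℕ.+ m)))
      deg₂ = ≡.trans (≡.cong (λ i → r ℕ.+ (s ℕ.+ (i ℕ.+ m))) (ℕₚ.+-suc t n))
        (≡.trans (≡.cong (r ℕ.+_) (ℕₚ.+-suc s _)) (ℕₚ.+-suc r _))

    𝐂-⊛ : ∀ {s t f g} r → 𝐂 P s f → 𝐂 P t g →
      Σ Seq λ h → 𝐂 P (r ℕ.+ (s ℕ.+ t)) h × iter r 𝐩 f ⊛ iter r 𝐩 g ≐ iter r 𝐩 h
    𝐂-⊛ {s} {t} r x y with h , xh , eq ← Φ-iter-𝐩 x y r 0 0 =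
      h , cast (≡.cong (λ i → r ℕ.+ (s ℕ.+ i)) (≡.trans (ℕₚ.+-identityʳ _) (ℕₚ.+-identityʳ t))) xh , eq

  -- Symmetric sequences

  -- The equation `i + j ≡ s` keeps truncated subtraction out of the inductions.
  SymSeq : ℕ → Seq → Set ℓ
  SymSeq s h = (∀ i j → i ℕ.+ j ≡ s → h i ≈ h j) × (∀ i → s ℕ.< i → h i ≈ 0#)

  SymSeq-⊕ : ∀ {s f g} → SymSeq s f → SymSeq s g → SymSeq s (f ⊕ g)
  SymSeq-⊕ (p , p′) (q , q′) =
    (λ i j e → +-cong (p i j e) (q i j e)) ,
    (λ i l → trans (+-cong (p′ i l) (q′ i l)) (+-identityʳ 0#))

  SymSeq-⊙ : ∀ {s f} a → SymSeq s f → SymSeq s (a ⊙ f)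
  SymSeq-⊙ a (p , p′) = (λ i j e → *-congˡ (p i j e)) , (λ i l → trans (*-congˡ (p′ i l)) (zeroʳ a))

  -- Multiplication by 1+x moves the center by 1/2 and multiplication by x moves it by 1, matching
  -- the degrees 1 and 2 of `𝐯` and `𝐬`.
  𝐇⇒SymSeq : ∀ {p} {P : Carrier → Set p} {s h} → 𝐇 P s h → SymSeq s h
  𝐇⇒SymSeq zero-in = (λ _ _ _ → refl) , (λ _ _ → refl)
  𝐇⇒SymSeq unit-in = (λ { zero zero _ → refl }) , (λ { (suc i) _ → refl })
  𝐇⇒SymSeq (A-in {s} {h} x) with 𝐇⇒SymSeq x
  ... | p , p′ = reflect , vanish
    where
    -- The extreme coefficients of `𝐯 h`, at 0 and s+1: `h (suc s)` vanishes and `h s` mirrors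
    -- `h 0`.
    end : h 0 + 0# ≈ h (suc s) + h s
    end = begin
      h 0 + 0#        ≈⟨ +-comm _ _ ⟩
      0# + h 0        ≈⟨ +-cong (p′ (suc s) ℕₚ.≤-refl) (p s 0 (ℕₚ.+-identityʳ s)) ⟨
      h (suc s) + h s ∎

    reflect : ∀ i j → i ℕ.+ j ≡ suc s → 𝐯 h i ≈ 𝐯 h j
    reflect zero    .(suc s) ≡.refl = end
    reflect (suc i) zero e with ≡.refl ← ≡.trans (≡.sym (ℕₚ.+-identityʳ i)) (ℕₚ.suc-injective e) = sym end
    reflect (suc i) (suc j) e = begin
      h (suc i) + h i ≈⟨ +-cong (p (suc i) j (≡.trans (≡.sym (ℕₚ.+-suc i j)) e′)) (p i (suc j) e′) ⟩
      h j + h (suc j) ≈⟨ +-comm _ _ ⟩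
      h (suc j) + h j ∎
      where
      e′ : i ℕ.+ suc j ≡ s
      e′ = ℕₚ.suc-injective e

    vanish : ∀ i → suc s ℕ.< i → 𝐯 h i ≈ 0#
    vanish (suc i) (s≤s l) = trans (+-cong (p′ (suc i) (ℕₚ.m≤n⇒m≤1+n l)) (p′ i l)) (+-identityʳ 0#)
  𝐇⇒SymSeq (B-in {s} {h} x) with 𝐇⇒SymSeq x
  ... | p , p′ = reflect , vanish
    where
    reflect : ∀ i j → i ℕ.+ j ≡ suc (suc s) → 𝐬 h i ≈ 𝐬 h j
    reflect zero    .(suc (suc s)) ≡.refl = sym (p′ (suc s) ℕₚ.≤-refl)
    reflect (suc i) zero e with ≡.refl ← ≡.trans (≡.sym (ℕₚ.+-identityʳ i)) (ℕₚ.suc-injective e) = p′ (suc s) ℕₚ.≤-refl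
    reflect (suc i) (suc j) e = p i j (ℕₚ.suc-injective (≡.trans (≡.sym (ℕₚ.+-suc i j)) (ℕₚ.suc-injective e)))

    vanish : ∀ i → suc (suc s) ℕ.< i → 𝐬 h i ≈ 0#
    vanish (suc i) (s≤s l) = p′ i (ℕₚ.<⇒≤ l)
  𝐇⇒SymSeq (⊕-in x y) = SymSeq-⊕ (𝐇⇒SymSeq x) (𝐇⇒SymSeq y)
  𝐇⇒SymSeq (⊙-in {a = a} _ x) = SymSeq-⊙ a (𝐇⇒SymSeq x)
  𝐇⇒SymSeq (≐-in q x) with 𝐇⇒SymSeq x
  ... | p , p′ = (λ i j e → trans (sym (q i)) (trans (p i j e) (q j))) , (λ i l → trans (sym (q i)) (p′ i l))

  iter-𝐯-in : ∀ {p} (P : Carrier → Set p) n → 𝐇 P n (iter n 𝐯 δ)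
  iter-𝐯-in P zero    = unit-in
  iter-𝐯-in P (suc n) = A-in (iter-𝐯-in P n)

  iter-𝐯-0 : ∀ n → iter n 𝐯 δ 0 ≈ 1#
  iter-𝐯-0 zero    = refl
  iter-𝐯-0 (suc n) = trans (+-identityʳ _) (iter-𝐯-0 n)

  Any : Carrier → Set
  Any _ = ⊤

  -- Subtract h₀(1+x)ˢ and divide by x.
  SymSeq⇒𝐇 : ∀ s {h} → SymSeq s h → 𝐇 Any s h
  SymSeq⇒𝐇 zero {h} (p , p′) = ≐-in eq (⊙-in {a = h 0} tt unit-in)
    where
    eq : h 0 ⊙ δ ≐ h
    eq zero    = *-identityʳ _
    eq (suc n) = trans (zeroʳ _) (sym (p′ (suc n) (s≤s z≤n)))
  SymSeq⇒𝐇 (suc zero) {h} (p , p′) = ≐-in eq (⊙-in {a = h 0} tt (A-in unit-in))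
    where
    eq : h 0 ⊙ 𝐯 δ ≐ h
    eq zero          = trans (*-congˡ (+-identityʳ 1#)) (*-identityʳ _)
    eq (suc zero)    = trans (*-congˡ (+-identityˡ 1#)) (trans (*-identityʳ _) (p 0 1 ≡.refl))
    eq (suc (suc n)) = trans (*-congˡ (+-identityʳ 0#)) (trans (zeroʳ _) (sym (p′ (suc (suc n)) (s≤s (s≤s z≤n)))))
  SymSeq⇒𝐇 (suc (suc s)) {h} sym-h =
    ≐-in eq (⊕-in (⊙-in {a = h 0} tt (iter-𝐯-in Any (suc (suc s)))) (B-in (SymSeq⇒𝐇 s (reflect , vanish))))
    where
    b h′ : Seq
    b  = iter (suc (suc s)) 𝐯 δ
    h′ = h ⊖ h 0 ⊙ b

    sym-h′ : SymSeq (suc (suc s)) h′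
    sym-h′ = SymSeq-⊕ sym-h (SymSeq-⊙ (- 1#) (SymSeq-⊙ (h 0) (𝐇⇒SymSeq (iter-𝐯-in Any (suc (suc s))))))

    h′-0 : h′ 0 ≈ 0#
    h′-0 = begin
      h 0 + - 1# * (h 0 * b 0) ≈⟨ +-congˡ (*-congˡ (trans (*-congˡ (iter-𝐯-0 (suc (suc s)))) (*-identityʳ _))) ⟩
      h 0 + - 1# * h 0         ≈⟨ x-x≈0 _ ⟩
      0#                       ∎

    reflect : ∀ i j → i ℕ.+ j ≡ s → h′ (suc i) ≈ h′ (suc j)
    reflect i j e = proj₁ sym-h′ (suc i) (suc j) (≡.cong suc (≡.trans (ℕₚ.+-suc i j) (≡.cong suc e)))

    vanish : ∀ i → s ℕ.< i → h′ (suc i) ≈ 0#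
    vanish i l with ℕₚ.m≤n⇒m<n∨m≡n l
    ... | inj₁ l′     = proj₂ sym-h′ (suc i) (s≤s l′)
    -- Here `suc i` is s+2, the top coefficient of `h′`, which mirrors the constant one and so was
    -- removed with it.
    ... | inj₂ ≡.refl = trans (proj₁ sym-h′ (suc (suc s)) 0 (ℕₚ.+-identityʳ _)) h′-0

    eq : h 0 ⊙ b ⊕ 𝐬 (λ i → h′ (suc i)) ≐ h
    eq zero    = trans (+-identityʳ _) (trans (*-congˡ (iter-𝐯-0 (suc (suc s)))) (*-identityʳ _))
    eq (suc n) = y+[x-y]≈x _ _

  -- Finite sums

  sumTo-cong-< : ∀ n {f g : Seq} → (∀ i → i ℕ.< n → f i ≈ g i) → sumTo n f ≈ sumTo n g
  sumTo-cong-< zero    p = refl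
  sumTo-cong-< (suc n) p = +-cong (sumTo-cong-< n (λ i l → p i (ℕₚ.m<n⇒m<1+n l))) (p n ℕₚ.≤-refl)

  sumTo-cong : ∀ n {f g : Seq} → f ≐ g → sumTo n f ≈ sumTo n g
  sumTo-cong n p = sumTo-cong-< n (λ i _ → p i)

  sumTo-𝟘 : ∀ n {f : Seq} → f ≐ 𝟘 → sumTo n f ≈ 0#
  sumTo-𝟘 zero    p = refl
  sumTo-𝟘 (suc n) p = trans (+-cong (sumTo-𝟘 n p) (p n)) (+-identityʳ 0#)

  sumTo-⊕ : ∀ n f g → sumTo n (f ⊕ g) ≈ sumTo n f + sumTo n g
  sumTo-⊕ zero    f g = sym (+-identityʳ 0#)
  sumTo-⊕ (suc n) f g = trans (+-congʳ (sumTo-⊕ n f g))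
    (solve 4 (λ a b c d → (a :+ b) :+ (c :+ d) := (a :+ c) :+ (b :+ d)) refl _ _ _ _)

  sumTo-⊙ : ∀ n a f → sumTo n (a ⊙ f) ≈ a * sumTo n f
  sumTo-⊙ zero    a f = sym (zeroʳ a)
  sumTo-⊙ (suc n) a f = trans (+-congʳ (sumTo-⊙ n a f)) (sym (distribˡ _ _ _))

  sumTo-suc : ∀ n (f : Seq) → sumTo (suc n) f ≈ f 0 + sumTo n (λ i → f (suc i))
  sumTo-suc zero    f = +-comm _ _
  sumTo-suc (suc n) f = trans (+-congʳ (sumTo-suc n f)) (+-assoc _ _ _)

  sumTo-in : ∀ {p} (P : Carrier → Set p) {s} n (f : ℕ → Seq) → (∀ i → i ℕ.< n → 𝐇 P s (f i)) →
             𝐇 P s (λ k → sumTo n (λ i → f i k))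
  sumTo-in P zero    f x = zero-in
  sumTo-in P (suc n) f x = ⊕-in (sumTo-in P n f (λ i l → x i (ℕₚ.m<n⇒m<1+n l))) (x n ℕₚ.≤-refl)

  -- The γ-basis

  basis : ℕ → ℕ → Seq
  basis s i = iter i 𝐬 (iter (s ∸ (i ℕ.+ i)) 𝐯 δ)

  iter-𝐬-in : ∀ {p} (P : Carrier → Set p) i {n h} → 𝐇 P n h → 𝐇 P ((i ℕ.+ i) ℕ.+ n) (iter i 𝐬 h)
  iter-𝐬-in P zero    x = x
  iter-𝐬-in P (suc i) {n} {h} x =
    ≡.subst (λ m → 𝐇 P (suc m ℕ.+ n) (iter (suc i) 𝐬 h)) (≡.sym (ℕₚ.+-suc i i)) (B-in (iter-𝐬-in P i x))

  basis-in : ∀ {p} (P : Carrier → Set p) {s} i → i ℕ.+ i ℕ.≤ s → 𝐇 P s (basis s i)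
  basis-in P {s} i l = ≡.subst (λ m → 𝐇 P m (basis s i)) (ℕₚ.m+[n∸m]≡n l)
    (iter-𝐬-in P i (iter-𝐯-in P (s ∸ (i ℕ.+ i))))

  𝐬𝐯-comm : ∀ f → 𝐬 (𝐯 f) ≐ 𝐯 (𝐬 f)
  𝐬𝐯-comm f = op-⊕ 𝐬-linear f (𝐬 f)

  basis-suc : ∀ s i → i ℕ.+ i ℕ.≤ s → basis (suc s) i ≐ 𝐯 (basis s i)
  basis-suc s i l rewrite ℕₚ.+-∸-assoc 1 l = iter-comm {B = 𝐯} 𝐬-linear 𝐬𝐯-comm i _

  basis-suc-suc : ∀ s i → basis (suc (suc s)) (suc i) ≡ 𝐬 (basis s i)
  basis-suc-suc s i rewrite ℕₚ.+-suc i i = ≡.refl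

  -- For 2i > s truncated subtraction makes `basis s i` the spurious element xⁱ; `γ-vanish` discards
  -- it. `expand` holds for every sufficiently large number of terms, so sums of equal length can be
  -- compared when `s` changes.
  record Expansion {p} (P : Carrier → Set p) (s : ℕ) (h : Seq) : Set (c ⊔ ℓ ⊔ p) where
    field
      γ        : Seq
      γ-in     : ∀ i → P (γ i)
      γ-vanish : ∀ i → s ℕ.< i ℕ.+ i → γ i ≈ 0#
      expand   : ∀ n → s ℕ.< n ℕ.+ n → ∀ k → h k ≈ sumTo n (λ i → γ i * basis s i k)

  open Expansion

  module _ {p} (P : Carrier → Set p) (P-0 : P 0#) (P-1 : P 1#)
           (P-+ : ∀ {a b} → P a → P b → P (a + b)) (P-* : ∀ {a b} → P a → P b → P (a * b)) where

    expansion-𝟘 : ∀ s → Expansion P s 𝟘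
    expansion-𝟘 s .γ = 𝟘
    expansion-𝟘 s .γ-in i = P-0
    expansion-𝟘 s .γ-vanish i l = refl
    expansion-𝟘 s .expand n l k = sym (sumTo-𝟘 n (λ i → zeroˡ _))

    expansion-δ : Expansion P 0 δ
    expansion-δ .γ = δ
    expansion-δ .γ-in zero    = P-1
    expansion-δ .γ-in (suc i) = P-0
    expansion-δ .γ-vanish (suc i) l = refl
    expansion-δ .expand (suc n) l k = sym (begin
      sumTo (suc n) (λ i → δ i * basis 0 i k)
        ≈⟨ sumTo-suc n (λ i → δ i * basis 0 i k) ⟩
      1# * δ k + sumTo n (λ i → 0# * basis 0 (suc i) k)
        ≈⟨ +-cong (*-identityˡ _) (sumTo-𝟘 n (λ i → zeroˡ _)) ⟩
      δ k + 0#
        ≈⟨ +-identityʳ _ ⟩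
      δ k ∎)

    expansion-𝐯 : ∀ {s h} → Expansion P s h → Expansion P (suc s) (𝐯 h)
    expansion-𝐯 E .γ = E .γ
    expansion-𝐯 E .γ-in = E .γ-in
    expansion-𝐯 E .γ-vanish i l = E .γ-vanish i (ℕₚ.<-trans (ℕₚ.n<1+n _) l)
    expansion-𝐯 {s} {h} E .expand n l k = begin
      h k + 𝐬 h k
        ≈⟨ +-cong (eq k) (op-cong 𝐬-linear eq k) ⟩
      sumTo n (λ i → E .γ i * basis s i k) + 𝐬 (λ j → sumTo n (λ i → E .γ i * basis s i j)) k
        ≈⟨ +-congˡ (𝐬-sum k) ⟩
      sumTo n (λ i → E .γ i * basis s i k) + sumTo n (λ i → E .γ i * 𝐬 (basis s i) k)
        ≈⟨ sumTo-⊕ n _ _ ⟨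
      sumTo n (λ i → E .γ i * basis s i k + E .γ i * 𝐬 (basis s i) k)
        ≈⟨ sumTo-cong n (λ i → trans (sym (distribˡ _ _ _)) (term i)) ⟩
      sumTo n (λ i → E .γ i * basis (suc s) i k) ∎
      where
      eq : h ≐ λ j → sumTo n (λ i → E .γ i * basis s i j)
      eq = E .expand n (ℕₚ.<-trans (ℕₚ.n<1+n _) l)

      𝐬-sum : ∀ k → 𝐬 (λ j → sumTo n (λ i → E .γ i * basis s i j)) k ≈ sumTo n (λ i → E .γ i * 𝐬 (basis s i) k)
      𝐬-sum zero    = sym (sumTo-𝟘 n (λ i → zeroʳ _))
      𝐬-sum (suc k) = refl

      term : ∀ i → E .γ i * 𝐯 (basis s i) k ≈ E .γ i * basis (suc s) i k
      -- The exponent s - 2i grows by one with `s` only if 2i ≤ s; otherwise the coefficient is zero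
      -- and the two sides agree trivially.
      term i with i ℕ.+ i ℕ.≤? s
      ... | yes i+i≤s = *-congˡ (sym (basis-suc s i i+i≤s k))
      ... | no  i+i≰s = trans (trans (*-congʳ γ≈0) (zeroˡ _)) (sym (trans (*-congʳ γ≈0) (zeroˡ _)))
        where γ≈0 = E .γ-vanish i (ℕₚ.≰⇒> i+i≰s)

    2+-< : ∀ {s} i → suc (suc s) ℕ.< suc i ℕ.+ suc i → s ℕ.< i ℕ.+ i
    2+-< i l rewrite ℕₚ.+-suc i i = ℕₚ.≤-pred (ℕₚ.≤-pred l)

    -- As s - 2i = (s+2) - 2(i+1), multiplication by x sends the i-th basis element for s to the
    -- (i+1)-st for s+2, so the coefficients shift by one place.
    expansion-𝐬 : ∀ {s h} → Expansion P s h → Expansion P (suc (suc s)) (𝐬 h)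
    expansion-𝐬 E .γ = 𝐬 (E .γ)
    expansion-𝐬 E .γ-in zero    = P-0
    expansion-𝐬 E .γ-in (suc i) = E .γ-in i
    expansion-𝐬 E .γ-vanish (suc i) l = E .γ-vanish i (2+-< i l)
    expansion-𝐬 {s} {h} E .expand (suc n) l k = sym (begin
      sumTo (suc n) (λ i → 𝐬 (E .γ) i * basis (suc (suc s)) i k)
        ≈⟨ sumTo-suc n (λ i → 𝐬 (E .γ) i * basis (suc (suc s)) i k) ⟩
      0# * basis (suc (suc s)) 0 k + sumTo n (λ i → E .γ i * basis (suc (suc s)) (suc i) k)
        ≈⟨ trans (+-congʳ (zeroˡ _)) (+-identityˡ _) ⟩
      sumTo n (λ i → E .γ i * basis (suc (suc s)) (suc i) k)
        ≈⟨ sumTo-cong n (λ i → *-congˡ (reflexive (≡.cong (λ f → f k) (basis-suc-suc s i)))) ⟩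
      sumTo n (λ i → E .γ i * 𝐬 (basis s i) k)
        ≈⟨ 𝐬-sum k ⟩
      𝐬 h k ∎)
      where
      𝐬-sum : ∀ k → sumTo n (λ i → E .γ i * 𝐬 (basis s i) k) ≈ 𝐬 h k
      𝐬-sum zero    = sumTo-𝟘 n (λ i → zeroʳ _)
      𝐬-sum (suc k) = sym (E .expand n (2+-< n l) k)

    expansion-⊕ : ∀ {s h k} → Expansion P s h → Expansion P s k → Expansion P s (h ⊕ k)
    expansion-⊕ E E′ .γ = E .γ ⊕ E′ .γ
    expansion-⊕ E E′ .γ-in i = P-+ (E .γ-in i) (E′ .γ-in i)
    expansion-⊕ E E′ .γ-vanish i l = trans (+-cong (E .γ-vanish i l) (E′ .γ-vanish i l)) (+-identityʳ 0#)
    expansion-⊕ E E′ .expand n l k = trans (+-cong (E .expand n l k) (E′ .expand n l k))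
      (trans (sym (sumTo-⊕ n _ _)) (sumTo-cong n (λ i → sym (distribʳ _ _ _))))

    expansion-⊙ : ∀ {s h a} → P a → Expansion P s h → Expansion P s (a ⊙ h)
    expansion-⊙ {a = a} pa E .γ = a ⊙ E .γ
    expansion-⊙ pa E .γ-in i = P-* pa (E .γ-in i)
    expansion-⊙ pa E .γ-vanish i l = trans (*-congˡ (E .γ-vanish i l)) (zeroʳ _)
    expansion-⊙ pa E .expand n l k = trans (*-congˡ (E .expand n l k))
      (trans (sym (sumTo-⊙ n _ _)) (sumTo-cong n (λ i → sym (*-assoc _ _ _))))

    expansion-≐ : ∀ {s h k} → h ≐ k → Expansion P s h → Expansion P s k
    expansion-≐ q E .γ = E .γ
    expansion-≐ q E .γ-in = E .γ-in
    expansion-≐ q E .γ-vanish = E .γ-vanish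
    expansion-≐ q E .expand n l k = trans (sym (q k)) (E .expand n l k)

    𝐇⇒Expansion : ∀ {s h} → 𝐇 P s h → Expansion P s h
    𝐇⇒Expansion {s} zero-in = expansion-𝟘 s
    𝐇⇒Expansion unit-in     = expansion-δ
    𝐇⇒Expansion (A-in x)    = expansion-𝐯 (𝐇⇒Expansion x)
    𝐇⇒Expansion (B-in x)    = expansion-𝐬 (𝐇⇒Expansion x)
    𝐇⇒Expansion (⊕-in x y)  = expansion-⊕ (𝐇⇒Expansion x) (𝐇⇒Expansion y)
    𝐇⇒Expansion (⊙-in a x)  = expansion-⊙ a (𝐇⇒Expansion x)
    𝐇⇒Expansion (≐-in q x)  = expansion-≐ q (𝐇⇒Expansion x)

  -- Coefficient vectors

  coeff-tabulate : ∀ {n} (g : Seq) {k} → k ℕ.< n → coeff (tabulate {n = n} (λ i → g (toℕ i))) k ≡ g k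
  coeff-tabulate {suc n} g {zero}  l       = ≡.refl
  coeff-tabulate {suc n} g {suc k} (s≤s l) = coeff-tabulate (λ i → g (suc i)) l

  coeff-≥ : ∀ {n} (v : Vec Carrier n) {k} → n ℕ.≤ k → coeff v k ≡ 0#
  coeff-≥ []      l       = ≡.refl
  coeff-≥ (a ∷ v) (s≤s l) = coeff-≥ v l

  coeff-lookup : ∀ {p} (P : Carrier → Set p) {n} (v : Vec Carrier n) →
                 (∀ i → P (lookup v i)) → ∀ {k} → k ℕ.< n → P (coeff v k)
  coeff-lookup P (a ∷ v) x {zero}  l       = x Fin.zero
  coeff-lookup P (a ∷ v) x {suc k} (s≤s l) = coeff-lookup P v (λ i → x (Fin.suc i)) l

  lookup-tabulate-in : ∀ {p} (P : Carrier → Set p) {n} (g : Seq) → (∀ i → P (g i)) →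
                       ∀ i → P (lookup (tabulate {n = n} (λ j → g (toℕ j))) i)
  lookup-tabulate-in P g x Fin.zero    = x 0
  lookup-tabulate-in P g x (Fin.suc i) = lookup-tabulate-in P (λ j → g (suc j)) (λ j → x (suc j)) i

  -- Cauchy products and powers of linear polynomials.

  conv : Seq → Seq → Seq
  conv a b k = sumTo (suc k) (λ i → a i * b (k ∸ i))

  conv-suc : ∀ a b k → conv a b (suc k) ≈ a 0 * b (suc k) + conv (λ i → a (suc i)) b k
  conv-suc a b k = sumTo-suc (suc k) (λ i → a i * b (suc k ∸ i))

  conv-linear : ∀ b → Linear (λ a → conv a b)
  conv-linear b .op-cong p k = sumTo-cong (suc k) (λ i → *-congʳ (p i))
  conv-linear b .op-⊕ f g k = trans (sumTo-cong (suc k) (λ i → distribʳ _ _ _)) (sumTo-⊕ (suc k) _ _)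
  conv-linear b .op-⊙ a f k = trans (sumTo-cong (suc k) (λ i → *-assoc _ _ _)) (sumTo-⊙ (suc k) a _)

  conv-𝐬 : ∀ a b → conv (𝐬 a) b ≐ 𝐬 (conv a b)
  conv-𝐬 a b zero    = trans (+-identityˡ _) (zeroˡ _)
  conv-𝐬 a b (suc k) = trans (conv-suc (𝐬 a) b k) (trans (+-congʳ (zeroˡ _)) (+-identityˡ _))

  conv-δ : ∀ b → conv δ b ≐ b
  conv-δ b zero    = trans (+-identityˡ _) (*-identityˡ _)
  conv-δ b (suc k) = trans (conv-suc δ b k)
    (trans (+-cong (*-identityˡ _) (op-𝟘 (conv-linear b) k)) (+-identityʳ _))

  coeff-[1] : coeff (1# ∷ []) ≐ δ
  coeff-[1] zero    = refl
  coeff-[1] (suc k) = refl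

  linear-factor : ∀ a b → coeff (a ∷ b ∷ []) ≐ a ⊙ δ ⊕ b ⊙ 𝐬 δ
  linear-factor a b zero          = sym (trans (+-cong (*-identityʳ a) (zeroʳ b)) (+-identityʳ a))
  linear-factor a b (suc zero)    = sym (trans (+-cong (zeroʳ a) (*-identityʳ b)) (+-identityˡ b))
  linear-factor a b (suc (suc k)) = sym (trans (+-cong (zeroʳ a) (zeroʳ b)) (+-identityʳ 0#))

  coeff-pow : ∀ a b n → coeff (pow (a ∷ b ∷ []) (suc n))
            ≐ a ⊙ coeff (pow (a ∷ b ∷ []) n) ⊕ b ⊙ 𝐬 (coeff (pow (a ∷ b ∷ []) n))
  coeff-pow a b n k with k ℕ.<? suc (suc n)
  ... | yes l = begin
    coeff (pow (a ∷ b ∷ []) (suc n)) k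
      ≈⟨ reflexive (coeff-tabulate (conv (coeff (a ∷ b ∷ [])) q) l) ⟩
    conv (coeff (a ∷ b ∷ [])) q k
      ≈⟨ op-cong (conv-linear q) (linear-factor a b) k ⟩
    conv (a ⊙ δ ⊕ b ⊙ 𝐬 δ) q k
      ≈⟨ trans (op-⊕ (conv-linear q) (a ⊙ δ) (b ⊙ 𝐬 δ) k)
               (+-cong (op-⊙ (conv-linear q) a δ k) (op-⊙ (conv-linear q) b (𝐬 δ) k)) ⟩
    a * conv δ q k + b * conv (𝐬 δ) q k
      ≈⟨ +-cong (*-congˡ (conv-δ q k)) (*-congˡ (trans (conv-𝐬 δ q k) (op-cong 𝐬-linear (conv-δ q) k))) ⟩
    a * q k + b * 𝐬 q k ∎
    where
    q : Seq
    q = coeff (pow (a ∷ b ∷ []) n)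
  -- Past the end of the vector `coeff` returns 0, so both coefficients on the right, at `k` and at
  -- its predecessor, have to vanish too.
  ... | no k≮2+n with k | ℕₚ.≮⇒≥ k≮2+n
  ...   | suc k′ | s≤s l = begin
    coeff (pow (a ∷ b ∷ []) (suc n)) (suc k′)
      ≈⟨ reflexive (coeff-≥ (pow (a ∷ b ∷ []) (suc n)) (s≤s l)) ⟩
    0#
      ≈⟨ trans (+-cong (zeroʳ a) (zeroʳ b)) (+-identityʳ 0#) ⟨
    a * 0# + b * 0#
      ≈⟨ reflexive (≡.cong₂ (λ x y → a * x + b * y) (coeff-≥ q (ℕₚ.m≤n⇒m≤1+n l)) (coeff-≥ q l)) ⟨
    a * coeff q (suc k′) + b * coeff q k′ ∎
    where
    q : Vec Carrier (suc n)
    q = pow (a ∷ b ∷ []) n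

  coeff-pow-onePlusX : ∀ n → coeff (pow onePlusX n) ≐ iter n 𝐯 δ
  coeff-pow-onePlusX zero    = coeff-[1]
  coeff-pow-onePlusX (suc n) k = trans (coeff-pow 1# 1# n k)
    (+-cong (trans (*-identityˡ _) (coeff-pow-onePlusX n k))
            (trans (*-identityˡ _) (op-cong 𝐬-linear (coeff-pow-onePlusX n) k)))

  -- Turns the convolution in the definition of `W` into an iterated backward difference, one factor
  -- 1-x at a time.
  conv-pow-oneMinusX : ∀ n f → conv (coeff (pow oneMinusX n)) f ≐ iter n ∇ f
  conv-pow-oneMinusX zero    f = ≐-trans (op-cong (conv-linear f) coeff-[1]) (conv-δ f)
  conv-pow-oneMinusX (suc n) f k = begin
    conv (coeff (pow oneMinusX (suc n))) f k
      ≈⟨ op-cong (conv-linear f) (coeff-pow 1# (- 1#) n) k ⟩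
    conv (1# ⊙ q ⊕ - 1# ⊙ 𝐬 q) f k
      ≈⟨ trans (op-⊕ (conv-linear f) (1# ⊙ q) (- 1# ⊙ 𝐬 q) k)
               (+-cong (op-⊙ (conv-linear f) 1# q k) (op-⊙ (conv-linear f) (- 1#) (𝐬 q) k)) ⟩
    1# * conv q f k + - 1# * conv (𝐬 q) f k
      ≈⟨ +-cong (*-identityˡ _) (*-congˡ (conv-𝐬 q f k)) ⟩
    ∇ (conv q f) k
      ≈⟨ op-cong ∇-linear (conv-pow-oneMinusX n f) k ⟩
    ∇ (iter n ∇ f) k ∎
    where
    q : Seq
    q = coeff (pow oneMinusX n)

  coeff-shift : ∀ {n} i (v : Vec Carrier n) → coeff (shift i v) ≐ iter i 𝐬 (coeff v)
  coeff-shift zero    v k       = refl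
  coeff-shift (suc i) v zero    = refl
  coeff-shift (suc i) v (suc k) = coeff-shift i v k

  coeff-gammaBasis : ∀ s i → coeff (gammaBasis s i) ≐ basis s i
  coeff-gammaBasis s i = ≐-trans (coeff-shift i (pow onePlusX (s ∸ (i ℕ.+ i))))
    (op-cong (iter-linear i 𝐬-linear) (coeff-pow-onePlusX (s ∸ (i ℕ.+ i))))

  -- Values of polynomials

  -- Horner evaluation of the first `n` terms of a sequence, so that coefficient vectors of
  -- different lengths can be padded with zeros and compared.
  evalTo : ℕ → Seq → Carrier → Carrier
  evalTo zero    a x = 0#
  evalTo (suc n) a x = a 0 + x * evalTo n (λ i → a (suc i)) x

  evalTo-cong : ∀ n {a b : Seq} x → a ≐ b → evalTo n a x ≈ evalTo n b x
  evalTo-cong zero    x p = refl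
  evalTo-cong (suc n) x p = +-cong (p 0) (*-congˡ (evalTo-cong n x (λ i → p (suc i))))

  evalTo-𝟘 : ∀ n x → evalTo n 𝟘 x ≈ 0#
  evalTo-𝟘 zero    x = refl
  evalTo-𝟘 (suc n) x = trans (+-identityˡ _) (trans (*-congˡ (evalTo-𝟘 n x)) (zeroʳ x))

  evalTo-⊙⊕ : ∀ n a f g x → evalTo n (a ⊙ f ⊕ g) x ≈ a * evalTo n f x + evalTo n g x
  evalTo-⊙⊕ zero    a f g x = sym (trans (+-identityʳ _) (zeroʳ a))
  evalTo-⊙⊕ (suc n) a f g x = trans (+-congˡ (*-congˡ (evalTo-⊙⊕ n a (λ i → f (suc i)) (λ i → g (suc i)) x)))
    (solve 6 (λ a f g x u v → (a :* f :+ g) :+ x :* (a :* u :+ v) := a :* (f :+ x :* u) :+ (g :+ x :* v)) refl _ _ _ _ _ _)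

  evalTo-coeff : ∀ {n} (v : Vec Carrier n) {m} x → n ℕ.≤ m → evalTo m (coeff v) x ≈ eval v x
  evalTo-coeff []      {m} x l   = evalTo-𝟘 m x
  evalTo-coeff (a ∷ v) x (s≤s l) = +-congˡ (*-congˡ (evalTo-coeff v x l))

  eval-tabulate : ∀ n (g : Seq) x → eval (tabulate {n = n} (λ i → g (toℕ i))) x ≡ evalTo n g x
  eval-tabulate zero    g x = ≡.refl
  eval-tabulate (suc n) g x = ≡.cong (λ y → g 0 + x * y) (eval-tabulate n (λ i → g (suc i)) x)

  -- Induction on the first factor: (a + xv)u = au + x(vu). The bound reflects that factors with n
  -- and m coefficients have a product with n + m - 1 of them.
  evalTo-conv : ∀ {n m} (v : Vec Carrier n) (u : Vec Carrier m) N x → n ℕ.+ m ℕ.≤ suc N →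
                evalTo N (conv (coeff v) (coeff u)) x ≈ eval v x * eval u x
  evalTo-conv [] u N x l = trans (trans (evalTo-cong N x (op-𝟘 (conv-linear (coeff u)))) (evalTo-𝟘 N x)) (sym (zeroˡ _))
  evalTo-conv (a ∷ v) [] zero x l = sym (zeroʳ _)
  evalTo-conv {suc n} (a ∷ v) (b ∷ u) zero x (s≤s l) with () ← ℕₚ.≤-trans (ℕₚ.m≤n+m _ n) l
  evalTo-conv {suc n} (a ∷ v) u (suc N) x (s≤s l) = begin
    conv (coeff (a ∷ v)) (coeff u) 0 + x * evalTo N (λ k → conv (coeff (a ∷ v)) (coeff u) (suc k)) x
      ≈⟨ +-cong (+-identityˡ _) (*-congˡ (trans (evalTo-cong N x (conv-suc (coeff (a ∷ v)) (coeff u)))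
           (evalTo-⊙⊕ N a (λ k → coeff u (suc k)) (conv (coeff v) (coeff u)) x))) ⟩
    a * coeff u 0 + x * (a * evalTo N (λ k → coeff u (suc k)) x + evalTo N (conv (coeff v) (coeff u)) x)
      ≈⟨ solve 5 (λ a b x e f → a :* b :+ x :* (a :* e :+ f) := a :* (b :+ x :* e) :+ x :* f) refl _ _ _ _ _ ⟩
    a * evalTo (suc N) (coeff u) x + x * evalTo N (conv (coeff v) (coeff u)) x
      ≈⟨ +-cong (*-congˡ (evalTo-coeff u x (ℕₚ.≤-trans (ℕₚ.m≤n+m _ n) l))) (*-congˡ (evalTo-conv v u N x l)) ⟩
    a * eval u x + x * (eval v x * eval u x)
      ≈⟨ solve 4 (λ a x v u → a :* u :+ x :* (v :* u) := (a :+ x :* v) :* u) refl _ _ _ _ ⟩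
    (a + x * eval v x) * eval u x ∎

  eval-mul : ∀ {d e} (p : Vec Carrier (suc d)) (q : Vec Carrier (suc e)) x → eval (mul p q) x ≈ eval p x * eval q x
  eval-mul {d} {e} p q x = trans
    (reflexive (eval-tabulate (suc (d ℕ.+ e)) (conv (coeff p) (coeff q)) x))
    (evalTo-conv p q (suc (d ℕ.+ e)) x (ℕₚ.≤-reflexive (≡.cong suc (ℕₚ.+-suc d e))))

  -- Values at the natural numbers and their differences.

  values : ∀ {n} → Vec Carrier n → Seq
  values v n = eval v (fromℕ n)

  -- Vanishing can start only at `k` because `𝐬` pads with 0, which leaves boundary terms at the
  -- first indices. For polynomial values these terms form the numerator.
  ∇-VanishFrom : ℕ → ℕ → Seq → Set ℓ
  ∇-VanishFrom m k f = ∀ {n} → k ℕ.≤ n → iter m ∇ f n ≈ 0#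

  ∇-vanish : ∀ {k f} → (∀ {n} → k ℕ.≤ n → f n ≈ 0#) → ∀ {n} → suc k ℕ.≤ n → ∇ f n ≈ 0#
  ∇-vanish p {suc n} (s≤s l) =
    trans (+-cong (p (ℕₚ.m≤n⇒m≤1+n l)) (trans (*-congˡ (p l)) (zeroʳ _))) (+-identityʳ 0#)

  𝐍 : Op
  𝐍 f n = fromℕ n * f n

  -- A Leibniz rule: n f(n) - (n-1) f(n-1) = n (f(n) - f(n-1)) + f(n-1).
  ∇𝐍 : ∀ f → ∇ (𝐍 f) ≐ 𝐍 (∇ f) ⊕ 𝐬 f
  ∇𝐍 f zero    = trans (+-cong (zeroˡ _) (zeroʳ _)) (sym (+-congʳ (zeroˡ _)))
  ∇𝐍 f (suc n) = sym (begin
    (1# + fromℕ n) * (f (suc n) + - 1# * f n) + f n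
      ≈⟨ +-congʳ (distribˡ _ _ _) ⟩
    (1# + fromℕ n) * f (suc n) + (1# + fromℕ n) * (- 1# * f n) + f n
      ≈⟨ +-congʳ (+-congˡ (trans (distribʳ _ _ _) (+-congʳ (*-identityˡ _)))) ⟩
    (1# + fromℕ n) * f (suc n) + (- 1# * f n + fromℕ n * (- 1# * f n)) + f n
      ≈⟨ solve 4 (λ a k x m → a :+ (k :* x :+ m :* (k :* x)) :+ x := a :+ k :* (m :* x) :+ (x :+ k :* x)) refl _ _ _ _ ⟩
    (1# + fromℕ n) * f (suc n) + - 1# * (fromℕ n * f n) + (f n + - 1# * f n)
      ≈⟨ trans (+-congˡ (x-x≈0 _)) (+-identityʳ _) ⟩
    (1# + fromℕ n) * f (suc n) + - 1# * (fromℕ n * f n) ∎)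

  ∇𝐬-comm : ∀ f → ∇ (𝐬 f) ≐ 𝐬 (∇ f)
  ∇𝐬-comm f n = sym (op-⊖ 𝐬-linear f (𝐬 f) n)

  ∇-iter-comm : ∀ n f → iter n ∇ (∇ f) ≐ ∇ (iter n ∇ f)
  ∇-iter-comm = iter-comm {B = ∇} ∇-linear (λ _ _ → refl)

  -- Multiplication by the index raises the degree by one and so costs one more difference. The
  -- Leibniz rule leaves `𝐍 (∇ f)`, handled by induction since `∇ f` needs one difference fewer, and
  -- `𝐬 f`, whose shift accounts for `suc k`.
  𝐍-VanishFrom : ∀ m {k f} → ∇-VanishFrom m k f → ∇-VanishFrom (suc m) (suc k) (𝐍 f)
  𝐍-VanishFrom zero p = ∇-vanish (λ l → trans (*-congˡ (p l)) (zeroʳ _))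
  𝐍-VanishFrom (suc m) {k} {f} p {suc n} (s≤s l) = begin
    iter (suc (suc m)) ∇ (𝐍 f) (suc n)
      ≈⟨ ∇-iter-comm (suc m) (𝐍 f) (suc n) ⟨
    iter (suc m) ∇ (∇ (𝐍 f)) (suc n)
      ≈⟨ trans (op-cong lin (∇𝐍 f) (suc n)) (op-⊕ lin (𝐍 (∇ f)) (𝐬 f) (suc n)) ⟩
    iter (suc m) ∇ (𝐍 (∇ f)) (suc n) + iter (suc m) ∇ (𝐬 f) (suc n)
      ≈⟨ +-cong (𝐍-VanishFrom m (λ {i} k≤i → trans (∇-iter-comm m f i) (p k≤i)) (s≤s l))
                (trans (iter-comm {B = 𝐬} ∇-linear ∇𝐬-comm (suc m) f (suc n)) (p l)) ⟩
    0# + 0#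
      ≈⟨ +-identityʳ 0# ⟩
    0# ∎
    where lin = iter-linear (suc m) ∇-linear

  const-VanishFrom : ∀ n a → ∇-VanishFrom (suc n) (suc n) (λ _ → a)
  const-VanishFrom zero    a {suc n} l = x-x≈0 a
  const-VanishFrom (suc n) a = ∇-vanish (const-VanishFrom n a)

  -- By Horner's rule the values of `a ∷ v` are the constant a plus `𝐍` of the values of `v`.
  values-VanishFrom : ∀ {n} (v : Vec Carrier n) → ∇-VanishFrom n n (values v)
  values-VanishFrom []              l = refl
  values-VanishFrom {suc n} (a ∷ v) {k} l =
    trans (op-⊕ (iter-linear (suc n) ∇-linear) (λ _ → a) (𝐍 (values v)) k)
    (trans (+-cong (const-VanishFrom n a l) (𝐍-VanishFrom n (values-VanishFrom v) l)) (+-identityʳ 0#))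

  -- Numerators of products.

  coeff-W : ∀ d (p : Vec Carrier (suc d)) → coeff (W d p) ≐ iter (suc d) ∇ (values p)
  coeff-W d p k with k ℕ.<? suc d
  ... | yes l = trans (reflexive (coeff-tabulate (conv (coeff (pow oneMinusX (suc d))) (values p)) l))
                      (conv-pow-oneMinusX (suc d) (values p) k)
  -- Above degree d the differences vanish as well, so the truncation built into `W` loses nothing.
  ... | no k≮ = trans (reflexive (coeff-≥ (W d p) (ℕₚ.≮⇒≥ k≮))) (sym (values-VanishFrom p (ℕₚ.≮⇒≥ k≮)))

  -- Inverts `coeff-W`. The d+1 factors `𝐩` are split as r + (s+1): the inner s+1 turn a numerator
  -- of degree s into a member of `𝐂`, and the outer r are the defect.
  values-W : ∀ r s (p : Vec Carrier (suc (r ℕ.+ s))) →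
             values p ≐ iter r 𝐩 (iter (suc s) 𝐩 (coeff (W (r ℕ.+ s) p)))
  values-W r s p = ≐-trans
    (≐-sym (iter-inverse {B = ∇} 𝐩-linear 𝐩∇≐id (suc (r ℕ.+ s)) (values p)))
    (≐-trans (op-cong (iter-linear (suc (r ℕ.+ s)) 𝐩-linear) (≐-sym (coeff-W (r ℕ.+ s) p)))
      (λ n → reflexive (≡.cong (λ f → f n)
        (≡.trans (≡.cong (λ m → iter m 𝐩 h) (≡.sym (ℕₚ.+-suc r s))) (iter-+ r (suc s) h)))))
    where
    h : Seq
    h = coeff (W (r ℕ.+ s) p)

  defect-sum : ∀ r s t → (r ℕ.+ s) ℕ.+ (r ℕ.+ t) ≡ r ℕ.+ (r ℕ.+ (s ℕ.+ t))
  defect-sum r s t = ≡.trans (ℕₚ.+-assoc r s (r ℕ.+ t)) (≡.cong (r ℕ.+_)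
    (≡.trans (≡.sym (ℕₚ.+-assoc s r t)) (≡.trans (≡.cong (ℕ._+ t) (ℕₚ.+-comm s r)) (ℕₚ.+-assoc r s t))))

  W-mul-in : ∀ {π} (P : Carrier → Set π) r s t (p : Vec Carrier (suc (r ℕ.+ s))) (q : Vec Carrier (suc (r ℕ.+ t))) →
    𝐇 P s (coeff (W (r ℕ.+ s) p)) → 𝐇 P t (coeff (W (r ℕ.+ t) q)) →
    𝐇 P (r ℕ.+ (s ℕ.+ t)) (coeff (W ((r ℕ.+ s) ℕ.+ (r ℕ.+ t)) (mul p q)))
  W-mul-in P r s t p q x y
    with f , f-in , f-eq ← 𝐂-⊛ P r (𝐇⇒𝐂 P x) (𝐇⇒𝐂 P y)
    with h , h-in , h-eq ← 𝐂⇒𝐇 P f-in = ≐-in eq h-in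
    where
    D u : ℕ
    D = (r ℕ.+ s) ℕ.+ (r ℕ.+ t)
    u = r ℕ.+ (s ℕ.+ t)

    D-eq : r ℕ.+ suc u ≡ suc D
    D-eq = ≡.trans (ℕₚ.+-suc r u) (≡.cong suc (≡.sym (defect-sum r s t)))

    values-eq : values (mul p q) ≐ iter (suc D) 𝐩 h
    values-eq n = begin
      values (mul p q) n
        ≈⟨ eval-mul p q (fromℕ n) ⟩
      values p n * values q n
        ≈⟨ *-cong (values-W r s p n) (values-W r t q n) ⟩
      iter r 𝐩 (iter (suc s) 𝐩 (coeff (W (r ℕ.+ s) p))) n * iter r 𝐩 (iter (suc t) 𝐩 (coeff (W (r ℕ.+ t) q))) n
        ≈⟨ f-eq n ⟩
      iter r 𝐩 f n
        ≈⟨ op-cong (iter-linear r 𝐩-linear) h-eq n ⟩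
      iter r 𝐩 (iter (suc u) 𝐩 h) n
        ≈⟨ reflexive (≡.cong (λ f → f n) (iter-+ r (suc u) h)) ⟨
      iter (r ℕ.+ suc u) 𝐩 h n
        ≈⟨ reflexive (≡.cong (λ m → iter m 𝐩 h n) D-eq) ⟩
      iter (suc D) 𝐩 h n ∎

    -- The numerator over (1-x)ᴰ⁺¹ is unique because `∇` inverts `𝐩`, so `h` is the numerator of the
    -- product.
    eq : h ≐ coeff (W D (mul p q))
    eq = ≐-sym (≐-trans (coeff-W D (mul p q)) (≐-trans (op-cong (iter-linear (suc D) ∇-linear) values-eq)
      (iter-inverse {B = 𝐩} ∇-linear ∇𝐩≐id (suc D) h)))

  Symmetric⇒SymSeq : ∀ {n s} (v : Vec Carrier n) → Symmetric s v → SymSeq s (coeff v)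
  Symmetric⇒SymSeq v (p , p′) =
    (λ { i j ≡.refl → trans (p i (ℕₚ.m≤m+n i j)) (reflexive (≡.cong (coeff v) (ℕₚ.m+n∸m≡n i j))) }) , p′

  SymSeq⇒Symmetric : ∀ {n s} (v : Vec Carrier n) → SymSeq s (coeff v) → Symmetric s v
  SymSeq⇒Symmetric v (p , p′) = (λ i l → p i _ (ℕₚ.m+[n∸m]≡n l)) , p′

  -- Nonnegativity and γ-positivity.

  Nonneg : Carrier → Set ℓ
  Nonneg a = 0# ≤ᶠ a

  private module ≤ᶠ = IsTotalOrder isTotalOrder

  nonneg-+ : ∀ {a b} → Nonneg a → Nonneg b → Nonneg (a + b)
  nonneg-+ {a} {b} p q = ≤ᶠ.trans q (≤ᶠ.≤-respˡ-≈ (+-identityˡ b) (+-monoʳ b p))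

  nonneg-1 : Nonneg 1#
  nonneg-1 with ≤ᶠ.total 0# 1#
  ... | inj₁ p = p
  -- If 1 ≤ 0 then 0 ≤ -1, and 1 = (-1)(-1) is a product of nonnegative elements.
  ... | inj₂ p = ≤ᶠ.≤-respʳ-≈ (trans (-1*x≈-x (- 1#)) (-‿involutive 1#)) (*-nonneg 0≤-1 0≤-1)
    where
    0≤-1 : Nonneg (- 1#)
    0≤-1 = ≤ᶠ.≤-respˡ-≈ (-‿inverseʳ 1#) (≤ᶠ.≤-respʳ-≈ (+-identityˡ (- 1#)) (+-monoʳ (- 1#) p))

  ⌊n/2⌋-lower : ∀ n → ⌊ n /2⌋ ℕ.+ ⌊ n /2⌋ ℕ.≤ n
  ⌊n/2⌋-lower zero          = z≤n
  ⌊n/2⌋-lower (suc zero)    = z≤n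
  ⌊n/2⌋-lower (suc (suc n)) rewrite ℕₚ.+-suc ⌊ n /2⌋ ⌊ n /2⌋ = s≤s (s≤s (⌊n/2⌋-lower n))

  ⌊n/2⌋-upper : ∀ n → n ℕ.< suc ⌊ n /2⌋ ℕ.+ suc ⌊ n /2⌋
  ⌊n/2⌋-upper zero          = s≤s z≤n
  ⌊n/2⌋-upper (suc zero)    = s≤s (s≤s z≤n)
  ⌊n/2⌋-upper (suc (suc n)) rewrite ℕₚ.+-suc ⌊ n /2⌋ (suc ⌊ n /2⌋) = s≤s (s≤s (⌊n/2⌋-upper n))

  GammaPositive⇒𝐇 : ∀ {n s} (v : Vec Carrier n) → GammaPositive s v → 𝐇 Nonneg s (coeff v)
  GammaPositive⇒𝐇 {s = s} v (γ , γ≥0 , eq) = ≐-in (≐-sym eq)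
    (sumTo-in Nonneg (suc ⌊ s /2⌋) (λ i → coeff γ i ⊙ coeff (gammaBasis s i)) λ i l →
      ⊙-in (coeff-lookup Nonneg γ γ≥0 l) (≐-in (≐-sym (coeff-gammaBasis s i)) (basis-in Nonneg i
        (ℕₚ.≤-trans (ℕₚ.+-mono-≤ (ℕₚ.≤-pred l) (ℕₚ.≤-pred l)) (⌊n/2⌋-lower s)))))

  𝐇⇒GammaPositive : ∀ {n s} (v : Vec Carrier n) → 𝐇 Nonneg s (coeff v) → GammaPositive s v
  𝐇⇒GammaPositive {s = s} v x =
    tabulate (λ i → E .γ (toℕ i)) , lookup-tabulate-in Nonneg (E .γ) (E .γ-in) , λ k →
      trans (E .expand (suc ⌊ s /2⌋) (⌊n/2⌋-upper s) k)
        (sumTo-cong-< (suc ⌊ s /2⌋) λ i l →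
          *-cong (reflexive (≡.sym (coeff-tabulate (E .γ) l))) (sym (coeff-gammaBasis s i k)))
    where
    E : Expansion Nonneg s (coeff v)
    E = 𝐇⇒Expansion Nonneg ≤ᶠ.refl nonneg-1 nonneg-+ *-nonneg x

  -- The closure result is used twice: with scalars in `Any`, where cone membership is the same as
  -- symmetry, and with scalars in `Nonneg`, where it is γ-positivity.
  W-mul : ∀ r s t {d e} (p : Vec Carrier (suc d)) (q : Vec Carrier (suc e)) → d ≡ r ℕ.+ s → e ≡ r ℕ.+ t →
    Symmetric s (W d p) → Symmetric t (W e q) →
    Symmetric (r ℕ.+ (s ℕ.+ t)) (W (d ℕ.+ e) (mul p q)) ×
    (GammaPositive s (W d p) → GammaPositive t (W e q) → GammaPositive (r ℕ.+ (s ℕ.+ t)) (W (d ℕ.+ e) (mul p q)))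
  W-mul r s t {d} {e} p q ≡.refl ≡.refl x y =
    SymSeq⇒Symmetric (W (d ℕ.+ e) (mul p q)) (𝐇⇒SymSeq (W-mul-in Any r s t p q
      (SymSeq⇒𝐇 s (Symmetric⇒SymSeq (W d p) x)) (SymSeq⇒𝐇 t (Symmetric⇒SymSeq (W e q) y)))) ,
    λ γx γy → 𝐇⇒GammaPositive (W (d ℕ.+ e) (mul p q))
      (W-mul-in Nonneg r s t p q (GammaPositive⇒𝐇 (W d p) γx) (GammaPositive⇒𝐇 (W e q) γy))

-- Degrees and the common defect.

open import Data.Nat using (_+_; _≤_)
open OrderedField using (Carrier)
open Poly

theorem1p3 : ∀ {c ℓ} (F : OrderedField c ℓ) →
    ∀ (d e : ℕ) (p : Vec (Carrier F) (suc d)) (q : Vec (Carrier F) (suc e)) →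
    NonZeroF F (lead F p) → NonZeroF F (lead F q) →
    ∀ (s t : ℕ) → s ≤ d → t ≤ e →
    Symmetric F s (W F d p) → Symmetric F t (W F e q) →
    d ∸ s ≡ e ∸ t →
    Σ ℕ λ u →
    u ≤ d + e ×
    Symmetric F u (W F (d + e) (mul F p q)) ×
    (d + e) ∸ u ≡ d ∸ s ×
    (d + e) ∸ u ≡ e ∸ t ×
    (GammaPositive F s (W F d p) → GammaPositive F t (W F e q) →
    GammaPositive F u (W F (d + e) (mul F p q)))
theorem1p3 F d e p q _ _ s t s≤d t≤e sym-p sym-q defects =
  u , ≡.subst (u ≤_) (≡.sym d+e≡r+u) (ℕₚ.m≤n+m u r) , proj₁ result , defect , ≡.trans defect defects , proj₂ result
  where
  r u : ℕ
  r = d ∸ s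
  -- Since d + e = 2r + s + t, a product of defect `r` must have this `u`.
  u = r + (s + t)

  d≡r+s : d ≡ r + s
  d≡r+s = ≡.sym (ℕₚ.m∸n+n≡m s≤d)

  e≡r+t : e ≡ r + t
  e≡r+t = ≡.trans (≡.sym (ℕₚ.m∸n+n≡m t≤e)) (≡.cong (_+ t) (≡.sym defects))

  d+e≡r+u : d + e ≡ r + u
  d+e≡r+u = ≡.trans (≡.cong₂ _+_ d≡r+s e≡r+t) (Sequences.defect-sum F r s t)

  defect : (d + e) ∸ u ≡ d ∸ s
  defect = ≡.trans (≡.cong (_∸ u) d+e≡r+u) (ℕₚ.m+n∸n≡m r u)

  result = Sequences.W-mul F r s t p q d≡r+s e≡r+t sym-p sym-q
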